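{- For all integers $g\geq 0$ and $d\geq 1$, every $(g,d)$-map graph has layered treewidth at most $(2g+3)(2d+1)$.
   Context: The Euler genus of the orientable surface with $h$ handles is $2h$; the Euler genus of the non-orientable surface with $c$ cross-caps is $c$. A $(g,d)$-map graph is defined as follows. Start with a graph $G_0$ embedded (without crossings) in a surface of Euler genus at most $g$, with each face labelled a "nation" or a "lake", where each vertex of $G_0$ is incident with at most $d$ nations. Let $G$ be the graph whose vertices are the nations of $G_0$, where two vertices are adjacent in $G$ if the corresponding faces of $G_0$ share a vertex. Then $G$ is called a $(g,d)$-map graph. A layering of a graph $G$ is a partition $(V_0,V_1,\dots,V_t)$ of $V(G)$ such that for every edge $vw\in E(G)$, if $v\in V_i$ and $w\in V_j$, then $|i-j|\leq 1$; each $V_i$ is called a layer. The layered width of a tree-decomposition $(B_x:x\in V(T))$ of $G$ is the minimum integer $\ell$ such that, for some layering $(V_0,V_1,\dots,V_t)$ of $G$, each bag $B_x$ contains at most $\ell$ vertices in each layer $V_i$. The layered treewidth of $G$ is the minimum layered width of a tree-decomposition of $G$. -}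

module Defs where

open import Data.Bool.Base using (Bool; not)
open import Data.Fin.Base using (Fin; toℕ)
open import Data.Fin.Properties using (_≟_)
open import Data.Fin.Subset using (Subset; _∈_; _∩_; ∣_∣)
open import Data.Integer.Base as ℤ using (ℤ; +_)
import Data.Integer.Properties as ℤ
open import Data.List.Base using (_∷_; _∷ʳ_; length)
open import Data.List.Relation.Unary.All using (All)
open import Data.List.Relation.Unary.Linked using (Linked)
open import Data.List.Relation.Unary.Unique.Propositional using (Unique)
open import Data.Nat.Base using (ℕ; suc; _+_; _≤_; _<_; ∣_-_∣)
open import Data.Product.Base using (Σ; ∃-syntax; _×_; _,_; proj₁)
open import Data.Vec.Base using (tabulate)
open import Function.Bundles using (_⇔_; _↔_; module Inverse)
open import Level using (0ℓ)
open import Relation.Binary.Core using (Rel)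
open import Relation.Binary.Construct.Closure.ReflexiveTransitive using (Star)
open import Relation.Binary.Definitions using (Symmetric; Irreflexive)
open import Relation.Binary.PropositionalEquality.Core using (_≡_; _≢_)
open import Relation.Nullary.Decidable.Core using (does)
open import Relation.Nullary.Negation.Core using (¬_)

import Algebra.Properties.CommutativeMonoid.Sum ℤ.+-0-commutativeMonoid as ℤSum

AtMost : ∀ {A : Set} → ℕ → (A → Set) → Set
AtMost k P = ∀ xs → Unique xs → All P xs → length xs ≤ k

preimage : ∀ {m n} → (Fin m → Fin n) → Fin n → Subset m
preimage f j = tabulate λ i → does (f i ≟ j)

------------------------------------------------------------------------
-- Finite simple graphs and layered treewidth

record Graph (n : ℕ) : Set₁ where
  field
    Adj    : Rel (Fin n) 0ℓ
    sym    : Symmetric Adj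
    irrefl : Irreflexive _≡_ Adj

record IsTree {t : ℕ} (T : Graph t) : Set where
  open Graph T
  field
    nonempty  : 0 < t
    connected : ∀ x y → Star Adj x y
    -- There is no cycle x – y – z – ⋯ – x on at least three distinct nodes.
    acyclic   : ∀ x y z zs → Unique (x ∷ y ∷ z ∷ zs) →
                ¬ Linked Adj ((x ∷ y ∷ z ∷ zs) ∷ʳ x)

record TreeDecomposition {n : ℕ} (G : Graph n) : Set₁ where
  private module G = Graph G
  field
    nodes  : ℕ
    tree   : Graph nodes
    isTree : IsTree tree
    bag    : Fin nodes → Subset n

  private module T = Graph tree

  field
    vertexCovered : ∀ v → ∃[ x ] v ∈ bag x
    edgeCovered   : ∀ {v w} → G.Adj v w → ∃[ x ] (v ∈ bag x × w ∈ bag x)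
    -- The nodes whose bags contain v induce a connected subgraph.
    coherent      : ∀ v x y → v ∈ bag x → v ∈ bag y →
                    Star (λ a b → T.Adj a b × v ∈ bag a × v ∈ bag b) x y

record Layering {n : ℕ} (G : Graph n) : Set where
  open Graph G
  field
    t       : ℕ
    layerOf : Fin n → Fin (suc t)
    close   : ∀ {v w} → Adj v w → ∣ toℕ (layerOf v) - toℕ (layerOf w) ∣ ≤ 1

  layer : Fin (suc t) → Subset n
  layer = preimage layerOf

-- Layered width and layered treewidth are minima, so they are at most k
-- exactly when a layering, respectively a decomposition, witnesses k.

LayeredWidth≤ : ∀ {n} {G : Graph n} → TreeDecomposition G → ℕ → Set
LayeredWidth≤ {G = G} D ℓ =
  Σ (Layering G) λ L → ∀ x i → ∣ bag x ∩ Layering.layer L i ∣ ≤ ℓ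
  where open TreeDecomposition D

LayeredTreewidth≤ : ∀ {n} → Graph n → ℕ → Set₁
LayeredTreewidth≤ G k = Σ (TreeDecomposition G) λ D → LayeredWidth≤ D k

------------------------------------------------------------------------
-- Graphs embedded in surfaces

-- Loops and parallel edges are allowed; edge e joins end e false and
-- end e true.
record Multigraph : Set where
  field
    #V #E : ℕ
    end   : Fin #E → Bool → Fin #V

  Isolated : Fin #V → Set
  Isolated v = ∀ e i → end e i ≢ v

  -- (e , i , s) is the part of the edge e near its end i, seen from its
  -- side s; the sides are named consistently along the whole edge.
  Flag : Set
  Flag = Fin #E × Bool × Bool

  otherEnd otherSide : Flag → Flag
  otherEnd  (e , i , s) = e , not i , s
  otherSide (e , i , s) = e , i , not s

  -- The places at which vertices meet faces.  An isolated vertex has no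
  -- flags, and is surrounded by a single face.
  data Site : Set where
    flag     : Flag → Site
    isolated : (v : Fin #V) → .(Isolated v) → Site

  vertexOf : Site → Fin #V
  vertexOf (flag (e , i , _)) = end e i
  vertexOf (isolated v _)     = v

  module Corners (corner : Flag → Flag) where

    data AroundVertex : Rel Flag 0ℓ where
      acrossEdge   : ∀ a → AroundVertex a (otherSide a)
      acrossCorner : ∀ a → AroundVertex a (corner a)

    data AlongBoundary : Rel Site 0ℓ where
      followEdge : ∀ a → AlongBoundary (flag a) (flag (otherEnd a))
      turnCorner : ∀ a → AlongBoundary (flag a) (flag (corner a))

-- An embedding, not necessarily cellular, of a finite graph in a closed
-- connected surface.  The surface is presented by the pieces obtained by
-- cutting it along the graph.
record Embedding (G₀ : Multigraph) : Set where
  open Multigraph G₀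
  field
    -- The flag across the corner (angle between consecutive edge-ends at
    -- a vertex) to which a flag belongs.
    corner            : Flag → Flag
    corner-involutive : ∀ a → corner (corner a) ≡ a
    corner-free       : ∀ a → corner a ≢ a

  open Corners corner

  field
    -- The edge-ends at a vertex form a single cyclic order, i.e. the vertex
    -- has a disc neighbourhood.
    rotation : ∀ a b → vertexOf (flag a) ≡ vertexOf (flag b) ⇔ Star AroundVertex a b

    -- Boundary components of faces: facial walks, and isolated vertices.
    #B                    : ℕ
    boundaryOf            : Site → Fin #B
    boundaryOf-surjective : ∀ w → ∃[ s ] boundaryOf s ≡ w
    boundaryOf-orbits     : ∀ s t → boundaryOf s ≡ boundaryOf t ⇔ Star AlongBoundary s t

    -- A face may have any number of boundary components.  Its topological
    -- type enters only through the Euler genus of the closed surface obtained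
    -- by capping those components with discs; every natural number is the
    -- Euler genus of some closed connected surface.
    #F        : ℕ
    faceOf    : Fin #B → Fin #F
    faceGenus : Fin #F → ℕ

  Incident : Fin #V → Fin #F → Set
  Incident v f = ∃[ s ] (vertexOf s ≡ v × faceOf (boundaryOf s) ≡ f)

  ShareVertex : Rel (Fin #F) 0ℓ
  ShareVertex f f′ = ∃[ v ] (Incident v f × Incident v f′)

  field
    -- The surface is nonempty and connected.  It is the union of the closures
    -- of the faces, and two such closures meet iff the faces share a vertex.
    nonempty  : 0 < #F
    connected : ∀ f f′ → Star ShareVertex f f′

  faceχ : Fin #F → ℤ
  faceχ f = + 2 ℤ.- + (faceGenus f + ∣ preimage faceOf f ∣)

  surfaceχ : ℤ
  surfaceχ = + #V ℤ.- + #E ℤ.+ ℤSum.sum faceχ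

  -- 2 - χ is 2h for the sphere with h handles and c for the sphere with c
  -- cross-caps.
  eulerGenus : ℤ
  eulerGenus = + 2 ℤ.- surfaceχ

------------------------------------------------------------------------
-- Map graphs

data Kind : Set where
  nation lake : Kind

record IsMapGraph (g d : ℕ) {n : ℕ} (G : Graph n) : Set where
  open Graph G
  field
    G₀        : Multigraph
    embedding : Embedding G₀

  open Embedding embedding using (#F; Incident; ShareVertex; eulerGenus)

  field
    genus≤ : eulerGenus ℤ.≤ + g
    kind   : Fin #F → Kind
    few    : ∀ v → AtMost d (λ f → kind f ≡ nation × Incident v f)

  Nation : Set
  Nation = ∃[ f ] kind f ≡ nation

  field
    vertices : Fin n ↔ Nation

  face : Fin n → Fin #F
  face u = proj₁ (Inverse.to vertices u)

  field
    adjacency : ∀ u v → Adj u v ⇔ (u ≢ v × ShareVertex (face u) (face v))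

{-# OPTIONS --safe #-}

-- Cap every boundary component of every face of G₀ with a disc and cone it from a
-- centre.  This gives triangles, one for each side of each edge of G₀.  Let T be a
-- breadth-first tree of the radial graph, whose vertices are the vertices and faces of
-- G₀ and whose edges are the corners.  The tree of the decomposition is a spanning tree
-- of the dual graph, in which triangles are adjacent across an edge of G₀ or across a
-- corner outside T; by Euler's formula at most g dual edges are left over.  The bag of a
-- triangle consists of the paths in T from its three corners and from the ends of
-- the left-over dual edges to the root: at most 2g + 3 paths, each meeting every
-- level at most once.  A vertex x of T that is not on the path of a left-over edge is in
-- the bags of the triangles at its descendants, and walking around the subtree below x
-- shows that these are connected in the dual tree.  Replacing each vertex of G₀ in a bag by
-- the at most d nations around it leaves at most 1 + 2d nations of a given level for each
-- path.
--
-- The dual graph also has a node for every face, joined to each boundary component of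
-- that face, and a node for every vertex.  The former keep the argument valid for faces
-- that are not discs, the latter for isolated vertices.

module Submission where

open import Defs

open import Data.Bool.Base using (Bool; true; false; if_then_else_)
import Data.Bool.Properties as Bool
open import Data.Empty using (⊥)
open import Data.Empty.Irrelevant using () renaming (⊥-elim to ⊥-elim-irr)
open import Data.Fin.Base as Fin using (Fin; zero; suc; toℕ; punchIn)
import Data.Fin.Properties as Fin
open import Data.Fin.Subset as Subset using (Subset; ∣_∣; inside; outside; _∩_)
open import Data.Fin.Subset.Properties using (x∈p∩q⁻)
open import Data.Integer.Base as ℤ using (ℤ; +_)
import Data.Integer.Properties as ℤ
import Data.Integer.Tactic.RingSolver as ℤ-Solver
open import Data.List.Base
  using (List; []; _∷_; _++_; _∷ʳ_; map; concatMap; length; lookup; filter; tabulate; allFin; cartesianProduct)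
import Data.List.Membership.DecPropositional as DecMembership
open import Data.List.Membership.Propositional using (_∈_; lose; find)
open import Data.List.Membership.Propositional.Properties
open import Data.List.Properties using (length-++; length-map; length-++-sucʳ; length-tabulate)
open import Data.List.Relation.Unary.All as All using (All; []; _∷_)
open import Data.List.Relation.Unary.AllPairs using ([]; _∷_)
open import Data.List.Relation.Unary.Any as Any using (Any; here; there; index)
import Data.List.Relation.Unary.Any.Properties as Any
open import Data.List.Relation.Unary.Linked using (Linked; _∷_)
open import Data.List.Relation.Unary.Unique.Propositional using (Unique)
import Data.List.Relation.Unary.Unique.Propositional.Properties as Unique
open import Data.Maybe.Base using (Maybe; just; nothing)
open import Data.Maybe.Properties using (just-injective) renaming (≡-dec to maybe-≡-dec)
open import Data.Nat.Base using (ℕ; zero; suc; pred; _+_; _*_; _∸_; ∣_-_∣; _≤_; _<_; z≤n; s≤s; s≤s⁻¹)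
open import Data.Nat.GeneralisedArithmetic using (fold)
import Data.Nat.Properties as ℕ
import Data.Nat.Tactic.RingSolver as ℕ-Solver
open import Data.Product.Base using (Σ; ∃; ∃-syntax; _×_; _,_; proj₁; proj₂; uncurry)
open import Data.Product.Function.NonDependent.Propositional using (_×-↔_)
open import Data.Product.Properties using () renaming (≡-dec to ×-≡-dec)
open import Data.Sum.Base using (_⊎_; inj₁; inj₂; [_,_]′; swap)
open import Data.Sum.Function.Propositional using (_⊎-↔_)
open import Data.Sum.Properties using (inj₁-injective; inj₂-injective) renaming (≡-dec to ⊎-≡-dec)
open import Data.Vec.Base as Vec using ([]; _∷_; here; there)
import Data.Vec.Properties as Vec
open import Function.Base using (_∘_; id; case_of_)
open import Function.Bundles using (_↔_; module Equivalence; module Inverse)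
open import Function.Properties.Inverse using (↔-refl; ↔-trans)
open import Level using (0ℓ)
open import Relation.Binary.Construct.Closure.ReflexiveTransitive as Star
  using (Star; ε; _◅_; _◅◅_; return; reverse)
open import Relation.Binary.Core using (Rel)
open import Relation.Binary.Definitions using (DecidableEquality; Symmetric; tri<; tri≈; tri>)
open import Relation.Binary.PropositionalEquality
  using (_≡_; _≢_; refl; sym; trans; cong; cong₂; subst; module ≡-Reasoning)
open import Relation.Binary.PropositionalEquality.WithK using (≡-irrelevant)
open import Relation.Nullary.Decidable
  using (Dec; yes; no; does; map′; ¬?; dec-true; _⊎-dec_; _×-dec_)
open import Relation.Nullary.Negation using (¬_; contradiction)
open import Relation.Unary using (Decidable)

import Algebra.Properties.CommutativeMonoid.Sum ℤ.+-0-commutativeMonoid as ℤSum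
import Algebra.Properties.CommutativeMonoid.Sum ℕ.+-0-commutativeMonoid as ℕSum

private variable
  A B : Set

-- Finite lists, subsets and decidable search

unique-⊆⇒length≤ : ∀ {xs ys : List A} → Unique xs → (∀ {x} → x ∈ xs → x ∈ ys) → length xs ≤ length ys
unique-⊆⇒length≤ {xs = []} _ _ = z≤n
unique-⊆⇒length≤ {xs = x ∷ xs} (x∉xs ∷ xs!) xs⊆ys with ∈-∃++ (xs⊆ys (here refl))
... | us , vs , refl = subst (suc (length xs) ≤_) (sym (length-++-sucʳ us x vs))
                         (s≤s (unique-⊆⇒length≤ xs! xs⊆us++vs))
  where
  xs⊆us++vs : ∀ {y} → y ∈ xs → y ∈ us ++ vs
  xs⊆us++vs y∈xs with ∈-++⁻ us (xs⊆ys (there y∈xs))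
  ... | inj₁ y∈us           = ∈-++⁺ˡ y∈us
  ... | inj₂ (here refl)    = contradiction refl (All.lookup x∉xs y∈xs)
  ... | inj₂ (there y∈vs)   = ∈-++⁺ʳ us y∈vs

length-allFin : ∀ n → length (allFin n) ≡ n
length-allFin n = length-tabulate id

unique-Fin⇒length≤ : ∀ {n} {xs : List (Fin n)} → Unique xs → length xs ≤ n
unique-Fin⇒length≤ {n} {xs} xs! =
  subst (length xs ≤_) (length-allFin n) (unique-⊆⇒length≤ xs! (λ {x} _ → ∈-allFin x))

unique-constant⇒length≤1 : ∀ {xs : List A} → Unique xs → (∀ {x y} → x ∈ xs → y ∈ xs → x ≡ y) → length xs ≤ 1
unique-constant⇒length≤1 {xs = []}        _                 _  = z≤n
unique-constant⇒length≤1 {xs = _ ∷ []}    _                 _  = s≤s z≤n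
unique-constant⇒length≤1 {xs = _ ∷ _ ∷ _} ((x≢y ∷ _) ∷ _) eq =
  contradiction (eq (here refl) (there (here refl))) x≢y

index-injective : ∀ {xs : List A} {x y} (p : x ∈ xs) (q : y ∈ xs) → index p ≡ index q → x ≡ y
index-injective {xs = xs} p q eq =
  trans (Any.lookup-index p) (trans (cong (lookup xs) eq) (sym (Any.lookup-index q)))

lookup-injective : ∀ {xs : List A} → Unique xs → ∀ {i j} → lookup xs i ≡ lookup xs j → i ≡ j
lookup-injective (_ ∷ _)   {zero}  {zero}  _  = refl
lookup-injective {xs = _ ∷ xs} (x∉ ∷ _)  {zero}  {suc j} eq = contradiction eq (All.lookup x∉ (∈-lookup {xs = xs} j))
lookup-injective {xs = _ ∷ xs} (x∉ ∷ _)  {suc i} {zero}  eq = contradiction (sym eq) (All.lookup x∉ (∈-lookup {xs = xs} i))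
lookup-injective (_ ∷ xs!) {suc i} {suc j} eq = cong suc (lookup-injective xs! eq)

elements : ∀ {n} → Subset n → List (Fin n)
elements []            = []
elements (inside ∷ p)  = zero ∷ map suc (elements p)
elements (outside ∷ p) = map suc (elements p)

length-elements : ∀ {n} (p : Subset n) → length (elements p) ≡ ∣ p ∣
length-elements []            = refl
length-elements (inside ∷ p)  = cong suc (trans (length-map suc (elements p)) (length-elements p))
length-elements (outside ∷ p) = trans (length-map suc (elements p)) (length-elements p)

elements-sound : ∀ {n} (p : Subset n) {i} → i ∈ elements p → i Subset.∈ p
elements-sound (inside ∷ p)  (here refl)  = here
elements-sound (inside ∷ p)  (there i∈)   with ∈-map⁻ suc i∈
... | _ , j∈ , refl = there (elements-sound p j∈)
elements-sound (outside ∷ p) i∈           with ∈-map⁻ suc i∈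
... | _ , j∈ , refl = there (elements-sound p j∈)

elements-unique : ∀ {n} (p : Subset n) → Unique (elements p)
elements-unique []            = []
elements-unique (inside ∷ p)  =
  All.tabulate (λ j∈ 0≡j → case ∈-map⁻ suc j∈ of λ { (_ , _ , refl) → contradiction 0≡j λ () })
  ∷ Unique.map⁺ Fin.suc-injective (elements-unique p)
elements-unique (outside ∷ p) = Unique.map⁺ Fin.suc-injective (elements-unique p)

-- The form in which bag sizes are bounded: a covering list suffices, and it may repeat entries.
∣⊆list∣ : ∀ {n} (p : Subset n) (xs : List (Fin n)) → (∀ {i} → i Subset.∈ p → i ∈ xs) → ∣ p ∣ ≤ length xs
∣⊆list∣ p xs p⊆xs = subst (_≤ length xs) (length-elements p)
  (unique-⊆⇒length≤ (elements-unique p) (p⊆xs ∘ elements-sound p))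

-- Leaves out the root when one tree edge is counted for every other element.
record Others {n} (i : Fin n) : Set where
  field
    {size}          : ℕ
    suc-size        : suc size ≡ n
    other           : Fin size → Fin n
    other-injective : ∀ {j k} → other j ≡ other k → j ≡ k
    other≢          : ∀ j → other j ≢ i

others : ∀ {n} (i : Fin n) → Others i
others {suc n} i = record
  { suc-size        = refl
  ; other           = punchIn i
  ; other-injective = λ {j} {k} → Fin.punchIn-injective i j k
  ; other≢          = Fin.punchInᵢ≢i i
  }

any-dec : ∀ {xs : List A} → (∀ x → x ∈ xs) → {P : A → Set} → Decidable P → Dec (∃ P)
any-dec {xs = xs} complete P? = map′ Any.satisfied (λ (x , px) → lose (complete x) px) (Any.any? P? xs)

least : ∀ {P : ℕ → Set} → Decidable P → ∀ n → P n → ∃[ m ] P m × (∀ k → P k → m ≤ k)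
least P? n pn with P? 0
least P? n       pn | yes p0 = 0 , p0 , λ _ _ → z≤n
least P? zero    pn | no ¬p0 = contradiction pn ¬p0
least P? (suc n) pn | no ¬p0 with least (P? ∘ suc) n pn
... | m , pm , min = suc m , pm , λ { zero p0 → contradiction p0 ¬p0 ; (suc k) pk → s≤s (min k pk) }

bounded : ∀ {n} (f : Fin n → ℕ) → ∃[ b ] (∀ i → f i ≤ b)
bounded {zero}  f = 0 , λ ()
bounded {suc n} f with bounded (f ∘ suc)
... | b , f≤b = f zero + b ,
  λ { zero → ℕ.m≤m+n _ _ ; (suc i) → ℕ.≤-trans (f≤b i) (ℕ.m≤n+m _ _) }

-- Rooted trees

-- `parent` is total but constrained only at positive depth; at depth 0 its value is arbitrary.
-- Several elements may have depth 0, so this is a forest until a single root is assumed.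
record Rooted (X : Set) : Set where
  field
    depth        : X → ℕ
    parent       : X → X
    parent-depth : ∀ {x k} → depth x ≡ suc k → depth (parent x) ≡ k

  Child : Rel X 0ℓ
  Child c p = depth c ≡ suc (depth p) × parent c ≡ p

  child-parent : ∀ {x k} → depth x ≡ suc k → Child x (parent x)
  child-parent eq = trans eq (cong suc (sym (parent-depth eq))) , refl

  -- The opposite reading of the pair would put each end one level below the other. This makes the
  -- map from non-root elements to their parent edges injective.
  child-ends : ∀ {e x y x′ y′} → Child x y → Child x′ y′ →
               e ≡ (x , y) ⊎ e ≡ (y , x) → e ≡ (x′ , y′) ⊎ e ≡ (y′ , x′) → x ≡ x′
  child-ends _        _         (inj₁ refl) (inj₁ refl) = refl
  child-ends _        _         (inj₂ refl) (inj₂ refl) = refl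
  child-ends (eq , _) (eq′ , _) (inj₁ refl) (inj₂ refl) = contradiction (trans eq (cong suc eq′)) (ℕ.m≢1+n+m _ {1})
  child-ends (eq , _) (eq′ , _) (inj₂ refl) (inj₁ refl) = contradiction (trans eq (cong suc eq′)) (ℕ.m≢1+n+m _ {1})

  data Anc (x : X) : X → Set where
    self  : Anc x x
    above : ∀ {c p} → Child c p → Anc x p → Anc x c

  anc-step : ∀ {c p y} → Child c p → Anc c y → Anc p y
  anc-step c self         = above c self
  anc-step c (above c′ a) = above c′ (anc-step c a)

  -- Opens the path at its upper end, whereas `above` opens it at the lower one.
  anc-child : ∀ {x y} → Anc x y → x ≡ y ⊎ ∃[ c ] Child c x × Anc c y
  anc-child self        = inj₁ refl
  anc-child (above c a) with anc-child a
  ... | inj₁ refl           = inj₂ (_ , c , self)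
  ... | inj₂ (d , dx , d≤p) = inj₂ (d , dx , above c d≤p)

  anc-depth : ∀ {x y} → Anc x y → depth x ≤ depth y
  anc-depth self              = ℕ.≤-refl
  anc-depth (above (eq , _) a) = ℕ.≤-trans (anc-depth a) (ℕ.≤-trans (ℕ.n≤1+n _) (ℕ.≤-reflexive (sym eq)))

  -- Truncated subtraction gives `y` itself when `j` is at least the depth of `y`.
  ancestorAt : ℕ → X → X
  ancestorAt j y = fold y parent (depth y ∸ j)

  -- A path to the root meets each level at most once, so its element there is a function of the
  -- level. The bound per layer rests on this.
  anc-at : ∀ {x y} → Anc x y → x ≡ ancestorAt (depth x) y
  anc-at {x} self rewrite ℕ.n∸n≡0 (depth x) = refl
  anc-at {x} {y} (above {p = p} (eq , refl) a)
    rewrite eq | ℕ.+-∸-assoc 1 (anc-depth a) = trans (anc-at a) (pull (depth p ∸ depth x))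
    where
    pull : ∀ n → fold p parent n ≡ parent (fold y parent n)
    pull zero    = refl
    pull (suc n) = cong parent (pull n)

  module _ (_≟_ : DecidableEquality X) where

    anc? : ∀ x y → Dec (Anc x y)
    anc? x y = go (depth y) y refl
      where
      go : ∀ k y → depth y ≡ k → Dec (Anc x y)
      go k       y eq with x ≟ y
      go k       y eq | yes refl = yes self
      go zero    y eq | no x≢y   = no λ
        { self → x≢y refl ; (above (eq′ , _) _) → contradiction (trans (sym eq) eq′) λ () }
      go (suc k) y eq | no x≢y   = map′ (above (child-parent eq))
        (λ { self → contradiction refl x≢y ; (above (_ , refl) a) → a })
        (go k (parent y) (parent-depth eq))

  Linkage : Rel X 0ℓ
  Linkage x y = Child x y ⊎ Child y x

  linkage-sym : Symmetric Linkage
  linkage-sym = λ { (inj₁ c) → inj₂ c ; (inj₂ c) → inj₁ c }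

  child-≢ : ∀ {x y} → x ≡ y → ¬ Child x y
  child-≢ refl (eq , _) = ℕ.1+n≢n (sym eq)

  private
    -- A walk without backtracking that has once moved away from the root keeps doing so.
    descending : ∀ a b cs x → Child b a → Linked Linkage (b ∷ cs ∷ʳ x) → Unique (a ∷ b ∷ cs) →
                 All (_≢ x) (a ∷ b ∷ cs) → depth a < depth x × ∃[ p ] p ∈ b ∷ cs × Child x p
    descending a b [] x (_ , refl) (inj₁ (_ , b→x) ∷ _) _ (a≢x ∷ _) = contradiction b→x a≢x
    descending a b [] x (db , _) (inj₂ xb@(dx , _) ∷ _) _ _ =
      ℕ.≤-trans (ℕ.≤-trans (ℕ.≤-reflexive (sym db)) (ℕ.n≤1+n _)) (ℕ.≤-reflexive (sym dx)) , b , here refl , xb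
    descending a b (c ∷ cs) x (_ , refl) (inj₁ (_ , b→c) ∷ _) ((_ ∷ a≢c ∷ _) ∷ _) _ = contradiction b→c a≢c
    descending a b (c ∷ cs) x (db , _) (inj₂ cb ∷ w) (_ ∷ u) (_ ∷ n)
      with descending b c cs x cb w u n
    ... | b<x , p , p∈ , xp = ℕ.<-trans (ℕ.≤-reflexive (sym db)) b<x , p , there p∈ , xp

    -- The walk climbs until its first step downwards, where `descending` takes over. Climbing alone
    -- only moves further above `x`, so `x` is entered from its parent.
    ascending : ∀ b cs x → depth b < depth x → Linked Linkage (b ∷ cs ∷ʳ x) → Unique (b ∷ cs) →
                All (_≢ x) (b ∷ cs) → ∃[ p ] p ∈ b ∷ cs × Child x p
    ascending b [] x b<x (inj₁ (db , _) ∷ _) _ _ =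
      contradiction (ℕ.<-trans b<x (ℕ.≤-reflexive (sym db))) (ℕ.<-irrefl refl)
    ascending b [] x b<x (inj₂ xb ∷ _) _ _ = b , here refl , xb
    ascending b (c ∷ cs) x b<x (inj₁ (db , _) ∷ w) (_ ∷ u) (_ ∷ n)
      with ascending c cs x (ℕ.<-trans (ℕ.≤-reflexive (sym db)) b<x) w u n
    ... | p , p∈ , xp = p , there p∈ , xp
    ascending b (c ∷ cs) x b<x (inj₂ cb ∷ w) u n with descending b c cs x cb w u n
    ... | _ , p , p∈ , xp = p , there p∈ , xp

  -- A cycle leaving `x` downwards keeps descending and cannot return. One leaving upwards for two
  -- steps, or upwards and then downwards, re-enters `x` from its parent, which is `y` and would be
  -- visited twice.
  linkage-acyclic : ∀ x y z zs → Unique (x ∷ y ∷ z ∷ zs) → ¬ Linked Linkage ((x ∷ y ∷ z ∷ zs) ∷ʳ x)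
  linkage-acyclic x y z zs ((x≢y ∷ x≢z ∷ x∉zs) ∷ _) (inj₂ (_ , y→x) ∷ inj₁ (_ , y→z) ∷ w) =
    x≢z (trans (sym y→x) y→z)
  linkage-acyclic x y z zs ((x≢y ∷ x≢z ∷ x∉zs) ∷ u) (inj₂ (dy , _) ∷ inj₂ zy ∷ w)
    with descending y z zs x zy w u (All.map (_∘ sym) (x≢y ∷ x≢z ∷ x∉zs))
  ... | y<x , _ = ℕ.<-asym y<x (ℕ.≤-reflexive (sym dy))
  linkage-acyclic x y z zs ((x≢y ∷ x≢z ∷ x∉zs) ∷ y∉ ∷ u) (inj₁ (dx , x→y) ∷ yz ∷ w)
    with yz
  ... | inj₁ (dy , _) with ascending z zs x
                             (ℕ.<-trans (ℕ.≤-reflexive (sym dy)) (ℕ.≤-reflexive (sym dx))) w u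
                             (All.map (_∘ sym) (x≢z ∷ x∉zs))
  ...   | p , p∈ , (_ , x→p) = All.lookup y∉ p∈ (trans (sym x→y) x→p)
  linkage-acyclic x y z zs ((x≢y ∷ x≢z ∷ x∉zs) ∷ y∉ ∷ u) (inj₁ (dx , x→y) ∷ yz ∷ w) | inj₂ zy
    with descending y z zs x zy w (y∉ ∷ u) (All.map (_∘ sym) (x≢y ∷ x≢z ∷ x∉zs))
  ...   | _ , p , p∈ , (_ , x→p) = All.lookup y∉ p∈ (trans (sym x→y) x→p)

  module _ {r : X} (root : ∀ {x} → depth x ≡ 0 → x ≡ r) where

    anc-root : ∀ x → Anc r x
    anc-root x = go (depth x) x refl
      where
      go : ∀ k x → depth x ≡ k → Anc r x
      go zero    x eq = subst (Anc r) (sym (root eq)) self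
      go (suc k) x eq = above (child-parent eq) (go k (parent x) (parent-depth eq))

    linkage-connected : ∀ x y → Star Linkage x y
    linkage-connected x y = up (anc-root x) ◅◅ reverse linkage-sym (up (anc-root y))
      where
      up : ∀ {x} → Anc r x → Star Linkage x r
      up self        = ε
      up (above c a) = inj₁ c ◅ up a

-- Breadth-first search

module BreadthFirst {X : Set} {universe : List X} (complete : ∀ x → x ∈ universe)
  (_≟_ : DecidableEquality X) {_~_ : Rel X 0ℓ} (~-sym : Symmetric _~_) (_~?_ : ∀ x y → Dec (x ~ y))
  (r : X) (reachable : ∀ x → Star _~_ r x) where

  Walk : ℕ → X → Set
  Walk zero    x = r ≡ x
  Walk (suc k) x = ∃[ y ] Walk k y × y ~ x

  private
    walk? : ∀ x k → Dec (Walk k x)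
    walk? x zero    = r ≟ x
    walk? x (suc k) = any-dec complete λ y → case walk? y k of λ where
      (no ¬w)  → no (¬w ∘ proj₁)
      (yes w)  → map′ (w ,_) proj₂ (y ~? x)

    walk : ∀ x → ∃[ k ] Walk k x
    walk x = extend (reachable x) (0 , refl)
      where
      extend : ∀ {y} → Star _~_ y x → ∃[ k ] Walk k y → ∃[ k ] Walk k x
      extend ε        w       = w
      extend (s ◅ ss) (k , w) = extend ss (suc k , _ , w , s)

    shortest : ∀ x → ∃[ m ] Walk m x × (∀ k → Walk k x → m ≤ k)
    shortest x = let k , w = walk x in least (walk? x) k w

  abstract
    depth : X → ℕ
    depth x = proj₁ (shortest x)

    depth-walk : ∀ x → Walk (depth x) x
    depth-walk x = proj₁ (proj₂ (shortest x))

    depth-least : ∀ {x k} → Walk k x → depth x ≤ k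
    depth-least {x} {k} = proj₂ (proj₂ (shortest x)) k

  depth-step : ∀ {x y} → x ~ y → depth y ≤ suc (depth x)
  depth-step {x} x~y = depth-least (x , depth-walk x , x~y)

  abstract
    private
      step : ∀ x → ∃[ y ] (∀ {k} → depth x ≡ suc k → depth y ≡ k × y ~ x)
      step x with depth x in eq | depth-walk x
      -- At the root `x` is a default value.
      ... | zero  | _           = x , λ ()
      -- A shortest walk has shortest prefixes: `w` bounds the depth of `y` by `k`, and a smaller
      -- depth would shorten the walk to `x`.
      ... | suc k | y , w , y~x = y , λ { refl →
        ℕ.≤-antisym (depth-least w) (s≤s⁻¹ (ℕ.≤-trans (ℕ.≤-reflexive (sym eq)) (depth-step y~x))) , y~x }

  tree : Rooted X
  tree = record { depth = depth ; parent = proj₁ ∘ step ; parent-depth = λ {x} eq → proj₁ (proj₂ (step x) eq) }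

  open Rooted tree public hiding (depth)

  child-~ : ∀ {x y} → Child x y → x ~ y
  child-~ {x} (eq , refl) = ~-sym (proj₂ (proj₂ (step x) eq))

  depth≡0⇒root : ∀ {x} → depth x ≡ 0 → x ≡ r
  depth≡0⇒root {x} eq = sym (subst (λ k → Walk k x) eq (depth-walk x))

  child-of-parent : ∀ {x} → x ≢ r → Child x (parent x)
  child-of-parent {x} x≢r = go (depth x) refl
    where
    go : ∀ k → depth x ≡ k → Child x (parent x)
    go zero    eq = contradiction (depth≡0⇒root eq) x≢r
    go (suc k) eq = child-parent eq

-- Spanning trees and left-over edges

module _ {N : ℕ} (ends : A → Fin N × Fin N) where

  Ends : A → Rel (Fin N) 0ℓ
  Ends l x y = ends l ≡ (x , y) ⊎ ends l ≡ (y , x)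

  Joined : List A → Rel (Fin N) 0ℓ
  Joined ls x y = Any (λ l → Ends l x y) ls

  joined-sym : ∀ {ls} → Symmetric (Joined ls)
  joined-sym = Any.map swap

  -- Every vertex other than `r` chooses a position in `ls` that joins it to its breadth-first
  -- parent. The choices are distinct, so the unchosen positions together with `N` - 1 chosen ones
  -- number at most the length of `ls`. Positions are counted instead of values because `ls` may
  -- contain repeated or parallel edges.
  spanningTree : (ls : List A) (r : Fin N) → (∀ x → Star (Joined ls) r x) →
    Σ (Graph N) λ T → IsTree T × ∃[ xs ]
      (∀ {l} → l ∈ ls → l ∈ xs ⊎ uncurry (Graph.Adj T) (ends l)) ×
      length xs + N ≤ suc (length ls)
  spanningTree ls r reachable = T , isTree , excess , excess-or-tree , count
    where
    _≟ᴺ_ : DecidableEquality (Fin N × Fin N)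
    _≟ᴺ_ = ×-≡-dec Fin._≟_ Fin._≟_

    joined? : ∀ x y → Dec (Joined ls x y)
    joined? x y = Any.any? (λ l → (ends l ≟ᴺ (x , y)) ⊎-dec (ends l ≟ᴺ (y , x))) ls

    open BreadthFirst ∈-allFin Fin._≟_ joined-sym joined? r reachable

    T : Graph N
    T = record { Adj = Linkage ; sym = linkage-sym
               ; irrefl = λ x≡y → [ child-≢ x≡y , child-≢ (sym x≡y) ]′ }

    isTree : IsTree T
    isTree = record { nonempty = ℕ.≤-trans (s≤s z≤n) (Fin.toℕ<n r)
                    ; connected = linkage-connected depth≡0⇒root ; acyclic = linkage-acyclic }

    upward : ∀ {x} → x ≢ r → Joined ls x (parent x)
    upward x≢r = child-~ (child-of-parent x≢r)

    open Others (others r) using (size; suc-size; other; other-injective; other≢)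

    position : Fin size → Fin (length ls)
    position j = index (upward (other≢ j))

    position-ends : ∀ j → Ends (lookup ls (position j)) (other j) (parent (other j))
    position-ends j = Any.lookup-index (upward (other≢ j))

    position-injective : ∀ {j k} → position j ≡ position k → j ≡ k
    position-injective {j} {k} eq = other-injective
      (child-ends (child-of-parent (other≢ j)) (child-of-parent (other≢ k)) (position-ends j)
        (subst (λ i → Ends (lookup ls i) (other k) _) (sym eq) (position-ends k)))

    chosen : List (Fin (length ls))
    chosen = tabulate position

    open DecMembership (Fin._≟_ {length ls}) using (_∈?_)

    unchosen : List (Fin (length ls))
    unchosen = filter (λ i → ¬? (i ∈? chosen)) (allFin _)

    excess : List A
    excess = map (lookup ls) unchosen

    excess-or-tree : ∀ {l} → l ∈ ls → l ∈ excess ⊎ uncurry Linkage (ends l)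
    excess-or-tree l∈ls with index l∈ls ∈? chosen
    ... | no  i∉ = inj₁ (subst (_∈ excess) (sym (Any.lookup-index l∈ls))
                     (∈-map⁺ (lookup ls) (∈-filter⁺ (λ i → ¬? (i ∈? chosen)) (∈-allFin _) i∉)))
    ... | yes i∈ with ∈-tabulate⁻ i∈
    ...   | j , eq = inj₂ (subst (uncurry Linkage ∘ ends)
                       (trans (cong (lookup ls) (sym eq)) (sym (Any.lookup-index l∈ls)))
                       (linkage (position-ends j)))
      where
      linkage : ∀ {l} → Ends l (other j) (parent (other j)) → uncurry Linkage (ends l)
      linkage (inj₁ eq) = subst (uncurry Linkage) (sym eq) (inj₁ (child-of-parent (other≢ j)))
      linkage (inj₂ eq) = subst (uncurry Linkage) (sym eq) (inj₂ (child-of-parent (other≢ j)))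

    unique : Unique (unchosen ++ chosen)
    unique = Unique.++⁺ (Unique.filter⁺ (λ i → ¬? (i ∈? chosen)) (Unique.allFin⁺ _))
      (Unique.tabulate⁺ position-injective)
      (λ (i∈ , i∈′) → proj₂ (∈-filter⁻ (λ i → ¬? (i ∈? chosen)) {xs = allFin _} i∈) i∈′)

    count : length excess + N ≤ suc (length ls)
    count = begin
      length excess + N                      ≡⟨ cong₂ _+_ (length-map (lookup ls) unchosen) (sym suc-size) ⟩
      length unchosen + suc size             ≡⟨ ℕ.+-suc (length unchosen) size ⟩
      suc (length unchosen + size)           ≡⟨ cong (λ k → suc (length unchosen + k)) (length-tabulate position) ⟨
      suc (length unchosen + length chosen)  ≡⟨ cong suc (length-++ unchosen) ⟨
      suc (length (unchosen ++ chosen))      ≤⟨ s≤s (unique-Fin⇒length≤ unique) ⟩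
      suc (length ls)                        ∎
      where open ℕ.≤-Reasoning

-- Two free involutions generate dihedral orbits, which stay connected when a
-- single link is removed.

module Dihedral {A : Set} {universe : List A} (complete : ∀ a → a ∈ universe) (_≟_ : DecidableEquality A)
  (σ τ : A → A) (σ-involutive : ∀ a → σ (σ a) ≡ a) (τ-involutive : ∀ a → τ (τ a) ≡ a)
  (σ-free : ∀ a → σ a ≢ a) (τ-free : ∀ a → τ a ≢ a) where

  private
    turn : A → A
    turn a = σ (τ a)

    turn-injective : ∀ {a b} → turn a ≡ turn b → a ≡ b
    turn-injective {a} {b} eq = trans (sym (τ-involutive a)) (trans (cong τ
      (trans (sym (σ-involutive (τ a))) (trans (cong σ eq) (σ-involutive (τ b))))) (τ-involutive b))

    turns : ℕ → A → A
    turns k a = fold a turn k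

    turns-shift : ∀ k a → turns k (turn a) ≡ turn (turns k a)
    turns-shift zero    a = refl
    turns-shift (suc k) a = cong turn (turns-shift k a)

    turns-cancel : ∀ i j a → i < j → turns i a ≡ turns j a → ∃[ k ] turns (suc k) a ≡ a
    turns-cancel zero    (suc j) a _   eq = j , sym eq
    turns-cancel (suc i) (suc j) a i<j eq = turns-cancel i j a (s≤s⁻¹ i<j) (turn-injective eq)

    -- An alternating word of odd length is a reflection, conjugate to `τ` or `σ`, and so inherits
    -- their freeness. Each recursive step strips one conjugation and shortens the word by two
    -- turns.
    no-reversal : ∀ k a → τ (turns k a) ≢ a
    no-reversal zero          a eq = τ-free a eq
    no-reversal (suc zero)    a eq = σ-free (τ a) (trans (sym (τ-involutive _)) (cong τ eq))
    no-reversal (suc (suc k)) a eq = no-reversal k (turn a)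
      (trans (cong τ (turns-shift k a))
      (trans (sym (σ-involutive _)) (cong σ (trans (sym (τ-involutive _)) (cong τ eq)))))

    -- Two iterates coincide by finiteness, and injectivity cancels the smaller one.
    recurrent : ∀ a → ∃[ k ] turns (suc k) a ≡ a
    recurrent a with Fin.pigeonhole (ℕ.n<1+n (length universe)) (λ i → index (complete (turns (toℕ i) a)))
    ... | i , j , i<j , eq =
      turns-cancel (toℕ i) (toℕ j) a i<j (index-injective (complete _) (complete _) eq)

  module _ {At : A → Set} (σ-At : ∀ {a} → At a → At (σ a)) (τ-At : ∀ {a} → At a → At (τ a))
    {C : A → A → Set} (C-trans : ∀ {a b c} → C a b → C b c → C a c)
    (p : A) (τ-C : ∀ {a} → At a → C a (τ a)) (σ-C : ∀ {a} → At a → a ≢ p → a ≢ σ p → C a (σ a)) where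

    -- Alternate `τ` and `σ` from `p` until the next turn would return to `p`; at that moment `τ`
    -- arrives at `σ p`. Before that no `σ`-step uses the missing link: `no-reversal` keeps it from
    -- starting at `p`, and starting at `σ p` would mean that the orbit has returned.
    detour : At p → C p (σ p)
    detour at with recurrent p
    ... | m , returns = go m 0 at (trans (turns-shift m p) returns)
      where
      go : ∀ m k → let a = turns k p in At a → turns m (turn a) ≡ p → C a (σ p)
      go m k at eq with turn (turns k p) ≟ p
      ... | yes returned = subst (C (turns k p)) (trans (sym (σ-involutive _)) (cong σ returned)) (τ-C at)
      go zero    k at eq | no ¬returned = contradiction eq ¬returned
      go (suc m) k at eq | no ¬returned = C-trans (τ-C at) (C-trans
        (σ-C (τ-At at) (no-reversal k p) (λ τ≡σ → ¬returned (trans (cong σ τ≡σ) (σ-involutive p))))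
        (go m (suc k) (σ-At (τ-At at)) (trans (turns-shift m _) eq)))

-- Euler's formula

private
  indicator : Bool → ℕ
  indicator b = if b then 1 else 0

∑-indicator-≟ : ∀ {n} (i : Fin n) → ℕSum.sum (λ j → indicator (does (i Fin.≟ j))) ≡ 1
∑-indicator-≟ {suc n} zero    = cong suc (ℕSum.sum-replicate-zero n)
∑-indicator-≟         (suc i) = ∑-indicator-≟ i

∣preimage-suc∣ : ∀ {m n} (f : Fin (suc m) → Fin n) j →
                 ∣ preimage f j ∣ ≡ indicator (does (f zero Fin.≟ j)) + ∣ preimage (f ∘ suc) j ∣
∣preimage-suc∣ f j with does (f zero Fin.≟ j)
... | true  = refl
... | false = refl

∑-∣preimage∣ : ∀ {m n} (f : Fin m → Fin n) → ℕSum.sum (λ j → ∣ preimage f j ∣) ≡ m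
∑-∣preimage∣ {zero}  {n} f = ℕSum.sum-replicate-zero n
∑-∣preimage∣ {suc m} f = begin
  ℕSum.sum (λ j → ∣ preimage f j ∣)
    ≡⟨ ℕSum.sum-cong-≗ (∣preimage-suc∣ f) ⟩
  ℕSum.sum (λ j → indicator (does (f zero Fin.≟ j)) + ∣ preimage (f ∘ suc) j ∣)
    ≡⟨ ℕSum.∑-distrib-+ (λ j → indicator (does (f zero Fin.≟ j))) (λ j → ∣ preimage (f ∘ suc) j ∣) ⟩
  ℕSum.sum (λ j → indicator (does (f zero Fin.≟ j))) + ℕSum.sum (λ j → ∣ preimage (f ∘ suc) j ∣)
    ≡⟨ cong₂ _+_ (∑-indicator-≟ (f zero)) (∑-∣preimage∣ (f ∘ suc)) ⟩
  suc m ∎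
  where open ≡-Reasoning

-- The boundary counts cancel, and each face is left with 2 minus its genus.
∑χ-≤ : ∀ {n} (γ β : Fin n → ℕ) →
       ℤSum.sum (λ f → + 2 ℤ.- + (γ f + β f)) ℤ.+ + ℕSum.sum β ℤ.≤ + (2 * n)
∑χ-≤ {zero}  γ β = ℤ.≤-refl
∑χ-≤ {suc n} γ β = begin
  (+ 2 ℤ.- (+ γ zero ℤ.+ + β zero) ℤ.+ S) ℤ.+ (+ β zero ℤ.+ + s)
    ≡⟨ rearrange (+ γ zero) (+ β zero) S (+ s) ⟩
  (+ 2 ℤ.+ (S ℤ.+ + s)) ℤ.- + γ zero
    ≤⟨ ℤ.i-j≤i (+ 2 ℤ.+ (S ℤ.+ + s)) (+ γ zero) ⟩
  + 2 ℤ.+ (S ℤ.+ + s)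
    ≤⟨ ℤ.+-monoʳ-≤ (+ 2) (∑χ-≤ (γ ∘ suc) (β ∘ suc)) ⟩
  + (2 + 2 * n)
    ≡⟨ cong +_ (sym (ℕ.*-suc 2 n)) ⟩
  + (2 * suc n) ∎
  where
  open ℤ.≤-Reasoning
  S = ℤSum.sum (λ f → + 2 ℤ.- + (γ (suc f) + β (suc f)))
  s = ℕSum.sum (β ∘ suc)
  rearrange : ∀ γ₀ β₀ S s → (+ 2 ℤ.- (γ₀ ℤ.+ β₀) ℤ.+ S) ℤ.+ (β₀ ℤ.+ s) ≡ (+ 2 ℤ.+ (S ℤ.+ s)) ℤ.- γ₀
  rearrange = ℤ-Solver.solve-∀

module _ {G₀ : Multigraph} (embedding : Embedding G₀) where
  open Multigraph G₀
  open Embedding embedding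

  -- Euler's formula as an inequality of natural numbers. The fibres of `faceOf` have total size
  -- `#B`, so `∑χ-≤` bounds the sum of `faceχ` plus `#B` by twice `#F`.
  euler-bound : ∀ {g} → eulerGenus ℤ.≤ + g → #B + #E + 2 ≤ g + #V + 2 * #F
  euler-bound {g} genus≤ = ℤ.drop‿+≤+ (begin
    + #B ℤ.+ + #E ℤ.+ + 2
      ≡⟨ expand (+ #B) (+ #E) (+ #V) χ ⟩
    eulerGenus ℤ.+ + #V ℤ.+ (χ ℤ.+ + #B)
      ≤⟨ ℤ.+-mono-≤ (ℤ.+-monoˡ-≤ (+ #V) genus≤) ∑χ ⟩
    + (g + #V + 2 * #F) ∎)
    where
    open ℤ.≤-Reasoning
    χ = ℤSum.sum faceχ
    ∑χ : χ ℤ.+ + #B ℤ.≤ + (2 * #F)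
    ∑χ = subst (λ b → χ ℤ.+ + b ℤ.≤ + (2 * #F)) (∑-∣preimage∣ faceOf)
           (∑χ-≤ faceGenus (λ f → ∣ preimage faceOf f ∣))
    expand : ∀ b e v χ → b ℤ.+ e ℤ.+ + 2 ≡ (+ 2 ℤ.- (v ℤ.- e ℤ.+ χ)) ℤ.+ v ℤ.+ (χ ℤ.+ b)
    expand = ℤ-Solver.solve-∀

-- The radial graph

length-cartesianProduct : ∀ {A B : Set} (xs : List A) (ys : List B) →
                          length (cartesianProduct xs ys) ≡ length xs * length ys
length-cartesianProduct []       ys = refl
length-cartesianProduct (x ∷ xs) ys = trans (length-++ (map (x ,_) ys))
  (cong₂ _+_ (length-map (x ,_) ys) (length-cartesianProduct xs ys))

module Radial {G₀ : Multigraph} (embedding : Embedding G₀) where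
  open Multigraph G₀ public
  open Embedding embedding public

  _≟ᶠˡ_ : DecidableEquality Flag
  _≟ᶠˡ_ = ×-≡-dec Fin._≟_ (×-≡-dec Bool._≟_ Bool._≟_)

  bools : List Bool
  bools = false ∷ true ∷ []

  flags : List Flag
  flags = cartesianProduct (allFin #E) (cartesianProduct bools bools)

  flags-complete : ∀ a → a ∈ flags
  flags-complete (e , i , s) = ∈-cartesianProduct⁺ (∈-allFin e) (∈-cartesianProduct⁺ (bool i) (bool s))
    where
    bool : ∀ b → b ∈ bools
    bool false = here refl
    bool true  = there (here refl)

  flags-unique : Unique flags
  flags-unique = Unique.cartesianProduct⁺ (Unique.allFin⁺ #E) (Unique.cartesianProduct⁺ bools! bools!)
    where
    bools! : Unique bools
    bools! = ((λ ()) ∷ []) ∷ [] ∷ []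

  length-flags : length flags ≡ #E * 4
  length-flags = trans (length-cartesianProduct (allFin #E) _) (cong (_* 4) (length-allFin #E))

  face : Site → Fin #F
  face s = faceOf (boundaryOf s)

  corner-vertex : ∀ a → vertexOf (flag (corner a)) ≡ vertexOf (flag a)
  corner-vertex a = sym (Equivalence.from (rotation a (corner a)) (return (Corners.acrossCorner a)))

  corner-face : ∀ a → face (flag (corner a)) ≡ face (flag a)
  corner-face a = cong faceOf (sym (Equivalence.from (boundaryOf-orbits _ _) (return (Corners.turnCorner a))))

  otherEnd-face : ∀ a → face (flag (otherEnd a)) ≡ face (flag a)
  otherEnd-face a = cong faceOf (sym (Equivalence.from (boundaryOf-orbits _ _) (return (Corners.followEdge a))))

  flag-or-isolated : ∀ v → (∃[ a ] vertexOf (flag a) ≡ v) ⊎ Isolated v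
  flag-or-isolated v with any-dec flags-complete (λ a → vertexOf (flag a) Fin.≟ v)
  ... | yes found  = inj₁ found
  ... | no ¬found  = inj₂ λ e i eq → ¬found ((e , i , false) , eq)

  siteAt : ∀ v → ∃[ s ] vertexOf s ≡ v
  siteAt v with flag-or-isolated v
  ... | inj₁ (a , eq) = flag a , eq
  ... | inj₂ iso      = isolated v iso , refl

  incident? : ∀ v f → Dec (Incident v f)
  incident? v f with flag-or-isolated v
  ... | inj₁ (a , eq) = map′ (λ (b , p) → flag b , p)
          (λ { (flag b , p) → b , p ; (isolated _ iso , refl , _) → ⊥-elim-irr (iso _ _ eq) })
          (any-dec flags-complete λ b → (vertexOf (flag b) Fin.≟ v) ×-dec (face (flag b) Fin.≟ f))
  ... | inj₂ iso      = map′ (λ p → isolated v iso , refl , p)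
          (λ { (flag b , p , _) → contradiction p (iso _ _) ; (isolated _ _ , refl , p) → p })
          (face (isolated v iso) Fin.≟ f)

  R : Set
  R = Fin #V ⊎ Fin #F

  _≟ᴿ_ : DecidableEquality R
  _≟ᴿ_ = ⊎-≡-dec Fin._≟_ Fin._≟_

  everyR : List R
  everyR = map inj₁ (allFin #V) ++ map inj₂ (allFin #F)

  everyR-complete : ∀ x → x ∈ everyR
  everyR-complete (inj₁ v) = ∈-++⁺ˡ (∈-map⁺ inj₁ (∈-allFin v))
  everyR-complete (inj₂ f) = ∈-++⁺ʳ (map inj₁ (allFin #V)) (∈-map⁺ inj₂ (∈-allFin f))

  _~_ : Rel R 0ℓ
  inj₁ v ~ inj₂ f = Incident v f
  inj₂ f ~ inj₁ v = Incident v f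
  inj₁ _ ~ inj₁ _ = ⊥
  inj₂ _ ~ inj₂ _ = ⊥

  ~-sym : Symmetric _~_
  ~-sym {inj₁ _} {inj₂ _} p = p
  ~-sym {inj₂ _} {inj₁ _} p = p

  _~?_ : ∀ x y → Dec (x ~ y)
  inj₁ v ~? inj₂ f = incident? v f
  inj₂ f ~? inj₁ v = incident? v f
  inj₁ _ ~? inj₁ _ = no id
  inj₂ _ ~? inj₂ _ = no id

  -- The root is a face, so every vertex of `G₀` has a parent in the radial tree.
  outer : Fin #F
  outer = Fin.fromℕ< nonempty

  root : R
  root = inj₂ outer

  reachable : ∀ x → Star _~_ root x
  reachable (inj₂ f) = go (connected outer f)
    where
    go : ∀ {f f′} → Star ShareVertex f f′ → Star _~_ (inj₂ f) (inj₂ f′)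
    go ε                  = ε
    go ((v , p , q) ◅ ss) = _◅_ {j = inj₁ v} p (q ◅ go ss)
  reachable (inj₁ v) = let s , eq = siteAt v in reachable (inj₂ (face s)) ◅◅ return (s , eq , refl)

  open BreadthFirst everyR-complete _≟ᴿ_ {_~_} (λ {x} {y} → ~-sym {x} {y}) _~?_ root reachable public

  -- A crude bound, enough to limit the number of layers and to drive the induction towards deeper
  -- elements.
  depthBound : ℕ
  depthBound = proj₁ (bounded (depth ∘ inj₁)) + proj₁ (bounded (depth ∘ inj₂))

  depth-bounded : ∀ x → depth x ≤ depthBound
  depth-bounded (inj₁ v) = ℕ.≤-trans (proj₂ (bounded (depth ∘ inj₁)) v) (ℕ.m≤m+n _ _)
  depth-bounded (inj₂ f) = ℕ.≤-trans (proj₂ (bounded (depth ∘ inj₂)) f) (ℕ.m≤n+m _ _)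

  ends : Site → R × R
  ends s = inj₁ (vertexOf s) , inj₂ (face s)

  Spans : Site → Rel R 0ℓ
  Spans s x y = ends s ≡ (x , y) ⊎ ends s ≡ (y , x)

  ~-site : ∀ x y → x ~ y → ∃[ s ] Spans s x y
  ~-site (inj₁ _) (inj₂ _) (s , refl , refl) = s , inj₁ refl
  ~-site (inj₂ _) (inj₁ _) (s , refl , refl) = s , inj₂ refl

  ends-corner : ∀ a → ends (flag (corner a)) ≡ ends (flag a)
  ends-corner a = cong₂ (λ v f → inj₁ v , inj₂ f) (corner-vertex a) (corner-face a)

  Spans-corner : ∀ {a x y} → Spans (flag (corner a)) x y → Spans (flag a) x y
  Spans-corner {a} {x} {y} = subst (λ e → e ≡ (x , y) ⊎ e ≡ (y , x)) (ends-corner a)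

  flagOf : Site → Maybe Flag
  flagOf (flag a)       = just a
  flagOf (isolated _ _) = nothing

  abstract
    parentSite : ∀ {x} → x ≢ root → ∃[ s ] Spans s x (parent x)
    parentSite {x} x≢r = ~-site x (parent x) (child-~ (child-of-parent x≢r))

  site-isolated : ∀ s v .(iso : Isolated v) → vertexOf s ≡ v → s ≡ isolated v iso
  site-isolated (isolated _ _) _ _   refl = refl
  site-isolated (flag _)       _ iso eq   = ⊥-elim-irr (iso _ _ eq)

  -- The only face at an isolated vertex is its parent, hence not one of its children.

  flagOf-parentSite-face : ∀ {f} (f≢r : inj₂ f ≢ root) → ∃[ a ] flagOf (proj₁ (parentSite f≢r)) ≡ just a
  flagOf-parentSite-face {f} f≢r with parentSite f≢r | child-of-parent f≢r
  ... | flag a , _             | _ = a , refl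
  ... | isolated v _ , inj₁ () | _
  ... | isolated v iso , inj₂ eq | c with parentSite {inj₁ v} (λ ())
  ...   | _ , inj₂ ()
  ...   | s , inj₁ eq′ = contradiction
          (child-ends c (child-of-parent {inj₁ v} (λ ())) (inj₂ eq)
            (inj₁ (subst (λ t → ends t ≡ (inj₁ v , parent (inj₁ v)))
                     (site-isolated s v iso (inj₁-injective (cong proj₁ eq′))) eq′)))
          λ ()

  flagOf-parentSite-vertex : ∀ a (v≢r : inj₁ (vertexOf (flag a)) ≢ root) →
                             ∃[ b ] flagOf (proj₁ (parentSite v≢r)) ≡ just b
  flagOf-parentSite-vertex a v≢r with parentSite v≢r
  ... | flag b , _                 = b , refl
  ... | isolated v iso , inj₁ eq   = ⊥-elim-irr (iso _ _ (inj₁-injective (sym (cong proj₁ eq))))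

  abstract
    -- The root and the isolated vertices have no parent flag.
    parentFlag : R → Maybe Flag
    parentFlag x with x ≟ᴿ root
    ... | yes _   = nothing
    ... | no x≢r = flagOf (proj₁ (parentSite x≢r))

    parentFlag-sound : ∀ {x a} → parentFlag x ≡ just a → Child x (parent x) × Spans (flag a) x (parent x)
    parentFlag-sound {x} eq with x ≟ᴿ root
    ... | no x≢r with parentSite x≢r
    parentFlag-sound {x} refl | no x≢r | flag _ , spans = child-of-parent x≢r , spans

    parentFlag-face : ∀ {f} → f ≢ outer → ∃[ a ] parentFlag (inj₂ f) ≡ just a
    parentFlag-face {f} f≢ with inj₂ f ≟ᴿ root
    ... | yes refl = contradiction refl f≢
    ... | no f≢r   = flagOf-parentSite-face f≢r

    parentFlag-vertex : ∀ a → ∃[ b ] parentFlag (inj₁ (vertexOf (flag a))) ≡ just b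
    parentFlag-vertex a with inj₁ (vertexOf (flag a)) ≟ᴿ root
    ... | no v≢r = flagOf-parentSite-vertex a v≢r

  parentFlag-end : ∀ {x a} → parentFlag x ≡ just a → x ≡ inj₁ (vertexOf (flag a)) ⊎ x ≡ inj₂ (face (flag a))
  parentFlag-end eq with proj₂ (parentFlag-sound eq)
  ... | inj₁ e = inj₁ (sym (cong proj₁ e))
  ... | inj₂ e = inj₂ (sym (cong proj₂ e))

  -- Counting the corners inside and outside the radial tree

  TreeFlag : Flag → Set
  TreeFlag a = ∃[ x ] parentFlag x ≡ just a

  _≟ᴹ_ : DecidableEquality (Maybe Flag)
  _≟ᴹ_ = maybe-≡-dec _≟ᶠˡ_

  treeFlag? : Decidable TreeFlag
  treeFlag? a = any-dec everyR-complete (λ x → parentFlag x ≟ᴹ just a)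

  -- The two flags of a corner have the same ends, so by `child-ends` they would both be the parent
  -- flag of one element. Hence a tree edge is represented by exactly one flag of its corner.
  treeFlag-corner : ∀ {a} → TreeFlag a → ¬ TreeFlag (corner a)
  treeFlag-corner {a} (x , eq) (y , eq′) with parentFlag-sound eq | parentFlag-sound eq′
  ... | c , spans | c′ , spans′ with child-ends c c′ spans (Spans-corner spans′)
  ...   | refl = corner-free a (just-injective (trans (sym eq′) eq))

  -- An arbitrary numbering, used to list each corner outside the tree by only one of its two flags.
  key : Flag → ℕ
  key a = toℕ (index (flags-complete a))

  key-injective : ∀ {a b} → key a ≡ key b → a ≡ b
  key-injective = index-injective (flags-complete _) (flags-complete _) ∘ Fin.toℕ-injective

  CrossCorner : Flag → Set
  CrossCorner a = key a < key (corner a) × ¬ TreeFlag a × ¬ TreeFlag (corner a)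

  crossCorner? : Decidable CrossCorner
  crossCorner? a = (key a ℕ.<? key (corner a)) ×-dec (¬? (treeFlag? a) ×-dec ¬? (treeFlag? (corner a)))

  crossCorners : List Flag
  crossCorners = filter crossCorner? flags

  ∈-crossCorners : ∀ {a} → CrossCorner a → a ∈ crossCorners
  ∈-crossCorners = ∈-filter⁺ crossCorner? (flags-complete _)

  -- Selects one flag at each vertex that is not isolated; the node of the vertex is attached there.
  VertexParentFlag : Flag → Set
  VertexParentFlag a = parentFlag (inj₁ (vertexOf (flag a))) ≡ just a

  vertexParentFlag? : Decidable VertexParentFlag
  vertexParentFlag? a = parentFlag (inj₁ (vertexOf (flag a))) ≟ᴹ just a

  vertexParentFlags : List Flag
  vertexParentFlags = filter vertexParentFlag? flags

  private
    open Others (others outer) using (size; suc-size; other; other-injective; other≢)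

    faceFlag : Fin size → Flag
    faceFlag j = proj₁ (parentFlag-face (other≢ j))

    faceFlag-eq : ∀ j → parentFlag (inj₂ (other j)) ≡ just (faceFlag j)
    faceFlag-eq j = proj₂ (parentFlag-face (other≢ j))

    faceFlag-face : ∀ j → face (flag (faceFlag j)) ≡ other j
    faceFlag-face j with parentFlag-end (faceFlag-eq j)
    ... | inj₂ eq = sym (inj₂-injective eq)

    faceFlags : List Flag
    faceFlags = tabulate faceFlag

    treeFlags : List Flag
    treeFlags = vertexParentFlags ++ faceFlags

    faceFlag-injective : ∀ {j k} → faceFlag j ≡ faceFlag k → j ≡ k
    faceFlag-injective {j} {k} eq = other-injective
      (trans (sym (faceFlag-face j)) (trans (cong (face ∘ flag) eq) (faceFlag-face k)))

    chosenFlags : List Flag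
    chosenFlags = crossCorners ++ treeFlags

    treeFlags-sound : ∀ {a} → a ∈ treeFlags → TreeFlag a
    treeFlags-sound {a} a∈ with ∈-++⁻ vertexParentFlags a∈
    ... | inj₁ a∈v = inj₁ (vertexOf (flag a)) , proj₂ (∈-filter⁻ vertexParentFlag? {xs = flags} a∈v)
    ... | inj₂ a∈f with ∈-tabulate⁻ a∈f
    ...   | j , refl = inj₂ (other j) , faceFlag-eq j

    treeFlags-unique : Unique treeFlags
    treeFlags-unique = Unique.++⁺ (Unique.filter⁺ vertexParentFlag? flags-unique)
                                  (Unique.tabulate⁺ faceFlag-injective) disjoint
      where
      disjoint : ∀ {a} → a ∈ vertexParentFlags × a ∈ faceFlags → ⊥
      disjoint (a∈v , a∈f) with ∈-tabulate⁻ a∈f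
      ... | j , refl with parentFlag-sound (proj₂ (∈-filter⁻ vertexParentFlag? {xs = flags} a∈v))
                        | parentFlag-sound (faceFlag-eq j)
      ...   | c , spans | c′ , spans′ = contradiction (child-ends c c′ spans spans′) λ ()

    crossCorners-sound : ∀ {a} → a ∈ crossCorners → CrossCorner a
    crossCorners-sound a∈ = proj₂ (∈-filter⁻ crossCorner? {xs = flags} a∈)

    chosenFlags-unique : Unique chosenFlags
    chosenFlags-unique = Unique.++⁺ (Unique.filter⁺ crossCorner? flags-unique) treeFlags-unique
      (λ (a∈c , a∈t) → proj₁ (proj₂ (crossCorners-sound a∈c)) (treeFlags-sound a∈t))

    chosen-case : ∀ {a} → a ∈ chosenFlags → CrossCorner a ⊎ TreeFlag a
    chosen-case a∈ with ∈-++⁻ crossCorners a∈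
    ... | inj₁ a∈c = inj₁ (crossCorners-sound a∈c)
    ... | inj₂ a∈t = inj₂ (treeFlags-sound a∈t)

    chosen-corner : ∀ {a} → CrossCorner a ⊎ TreeFlag a → ¬ (CrossCorner (corner a) ⊎ TreeFlag (corner a))
    chosen-corner {a} (inj₁ (lt , _)) (inj₁ (gt , _)) =
      ℕ.<-asym lt (subst (λ b → key (corner a) < key b) (corner-involutive a) gt)
    chosen-corner (inj₁ (_ , _ , ¬t)) (inj₂ t) = ¬t t
    chosen-corner {a} (inj₂ t) (inj₁ (_ , _ , ¬t)) = ¬t (subst TreeFlag (sym (corner-involutive a)) t)
    chosen-corner (inj₂ t) (inj₂ t′) = treeFlag-corner t t′

    corner-injective : ∀ {a b} → corner a ≡ corner b → a ≡ b
    corner-injective eq = trans (sym (corner-involutive _)) (trans (cong corner eq) (corner-involutive _))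

    -- At most one flag of each corner is chosen, so the chosen flags and their images under
    -- `corner` are all distinct.
    chosenFlags-double : length chosenFlags + length chosenFlags ≤ #E * 4
    chosenFlags-double = begin
      length chosenFlags + length chosenFlags
        ≡⟨ cong (λ k → length chosenFlags + k) (length-map corner chosenFlags) ⟨
      length chosenFlags + length (map corner chosenFlags)
        ≡⟨ length-++ chosenFlags ⟨
      length (chosenFlags ++ map corner chosenFlags)
        ≤⟨ unique-⊆⇒length≤ unique (λ {a} _ → flags-complete a) ⟩
      length flags
        ≡⟨ length-flags ⟩
      #E * 4 ∎
      where
      open ℕ.≤-Reasoning
      unique : Unique (chosenFlags ++ map corner chosenFlags)
      unique = Unique.++⁺ chosenFlags-unique (Unique.map⁺ corner-injective chosenFlags-unique) λ (a∈ , a∈c) →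
        case ∈-map⁻ corner a∈c of λ { (b , b∈ , refl) → chosen-corner (chosen-case b∈) (chosen-case a∈) }

  -- The `4 #E` flags form `2 #E` corners. Among these are, without overlap, the corners outside the
  -- tree, the parent corners of the non-isolated vertices and those of the `#F` - 1 faces other
  -- than the root.
  chosen-count : length crossCorners + length vertexParentFlags + #F ≤ suc (#E * 2)
  chosen-count = begin
    c + v + #F                  ≡⟨ cong (λ k → c + v + k) (sym suc-size) ⟩
    c + v + suc size             ≡⟨ ℕ.+-suc (c + v) size ⟩
    suc (c + v + size)             ≡⟨ cong suc (ℕ.+-assoc c v size) ⟩
    suc (c + (v + size))           ≡⟨ cong (λ k → suc (c + (v + k))) (length-tabulate faceFlag) ⟨
    suc (c + (v + length faceFlags)) ≡⟨ cong (λ k → suc (c + k)) (length-++ vertexParentFlags) ⟨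
    suc (c + length treeFlags)  ≡⟨ cong suc (length-++ crossCorners) ⟨
    suc (length chosenFlags)    ≤⟨ s≤s (ℕ.*-cancelʳ-≤ _ _ 2 double) ⟩
    suc (#E * 2)                ∎
    where
    open ℕ.≤-Reasoning
    c = length crossCorners
    v = length vertexParentFlags
    double : length chosenFlags * 2 ≤ #E * 2 * 2
    double = begin
      length chosenFlags * 2                    ≡⟨ ℕ.*-comm (length chosenFlags) 2 ⟩
      length chosenFlags + (length chosenFlags + 0) ≡⟨ cong (λ k → length chosenFlags + k) (ℕ.+-identityʳ _) ⟩
      length chosenFlags + length chosenFlags   ≤⟨ chosenFlags-double ⟩
      #E * 4                                    ≡⟨ ℕ.*-assoc #E 2 2 ⟨
      #E * 2 * 2                                ∎

-- The dual graph

module Pieces {G₀ : Multigraph} (embedding : Embedding G₀) where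
  open Radial embedding public

  Piece : Set
  Piece = (Fin #E × Bool) ⊎ (Fin #F ⊎ Fin #V)

  pattern side e s  = inj₁ (e , s)
  pattern inFace f  = inj₂ (inj₁ f)
  pattern atVertex v = inj₂ (inj₂ v)

  pieceOf : Site → Piece
  pieceOf (flag (e , _ , s)) = side e s
  pieceOf (isolated v _)     = atVertex v

  -- The meeting point of all pieces touched by `x` or its descendants: connectedness is shown by
  -- leading each of them here.
  hub : R → Piece
  hub (inj₁ v) = atVertex v
  hub (inj₂ f) = inFace f

  private
    -- The node of an isolated vertex also serves as the piece of its only site, hence it touches
    -- the surrounding face.
    touchingVertex : ∀ {v} → (∃[ a ] vertexOf (flag a) ≡ v) ⊎ Isolated v → List R
    touchingVertex {v} (inj₁ _)   = inj₁ v ∷ []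
    touchingVertex {v} (inj₂ iso) = inj₁ v ∷ inj₂ (face (isolated v iso)) ∷ []

  touching : Piece → List R
  -- Both ends of a side lie in the same face, so it may be read off at the end `false`.
  touching (side e s)   = inj₁ (end e false) ∷ inj₁ (end e true) ∷ inj₂ (face (flag (e , false , s))) ∷ []
  touching (inFace f)   = inj₂ f ∷ []
  touching (atVertex v) = touchingVertex (flag-or-isolated v)

  length-touching : ∀ p → length (touching p) ≤ 3
  length-touching (side e s)   = ℕ.≤-refl
  length-touching (inFace f)   = s≤s z≤n
  length-touching (atVertex v) with flag-or-isolated v
  ... | inj₁ _ = s≤s z≤n
  ... | inj₂ _ = s≤s (s≤s z≤n)

  EndOf : Site → R → Set
  EndOf s x = x ≡ inj₁ (vertexOf s) ⊎ x ≡ inj₂ (face s)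

  endOf-corner : ∀ {a x} → EndOf (flag a) x → EndOf (flag (corner a)) x
  endOf-corner {a} (inj₁ refl) = inj₁ (cong inj₁ (sym (corner-vertex a)))
  endOf-corner {a} (inj₂ refl) = inj₂ (cong inj₂ (sym (corner-face a)))

  spans-endOf : ∀ {s x y} → Spans s x y → EndOf s x × EndOf s y
  spans-endOf (inj₁ refl) = inj₁ refl , inj₂ refl
  spans-endOf (inj₂ refl) = inj₂ refl , inj₁ refl

  touching-hub : ∀ x → x ∈ touching (hub x)
  touching-hub (inj₂ f) = here refl
  touching-hub (inj₁ v) with flag-or-isolated v
  ... | inj₁ _ = here refl
  ... | inj₂ _ = here refl

  touching-pieceOf : ∀ s {x} → EndOf s x → x ∈ touching (pieceOf s)
  touching-pieceOf (flag (e , false , s)) (inj₁ refl) = here refl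
  touching-pieceOf (flag (e , true , s))  (inj₁ refl) = there (here refl)
  touching-pieceOf (flag (e , false , s)) (inj₂ refl) = there (there (here refl))
  touching-pieceOf (flag (e , true , s))  (inj₂ refl) = there (there (here (cong inj₂ (otherEnd-face (e , false , s)))))
  touching-pieceOf (isolated v iso) (inj₁ refl) = touching-hub (inj₁ v)
  touching-pieceOf (isolated v iso) (inj₂ refl) with flag-or-isolated v
  ... | inj₁ (_ , eq) = ⊥-elim-irr (iso _ _ eq)
  ... | inj₂ _        = there (here refl)

  touching-cases : ∀ p {x} → x ∈ touching p → p ≡ hub x ⊎ ∃[ s ] pieceOf s ≡ p × EndOf s x
  touching-cases (side e s)   (here refl)                 = inj₂ (flag (e , false , s) , refl , inj₁ refl)
  touching-cases (side e s)   (there (here refl))         = inj₂ (flag (e , true , s) , refl , inj₁ refl)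
  touching-cases (side e s)   (there (there (here refl))) = inj₂ (flag (e , false , s) , refl , inj₂ refl)
  touching-cases (inFace f)   (here refl)                 = inj₁ refl
  touching-cases (atVertex v) x∈ with flag-or-isolated v
  touching-cases (atVertex v) (here refl)         | inj₁ _   = inj₁ refl
  touching-cases (atVertex v) (here refl)         | inj₂ _   = inj₁ refl
  touching-cases (atVertex v) (there (here refl)) | inj₂ iso = inj₂ (isolated v iso , refl , inj₂ refl)

  touching-nonempty : ∀ p → ∃[ x ] x ∈ touching p
  touching-nonempty (side e s)   = _ , here refl
  touching-nonempty (inFace f)   = _ , here refl
  touching-nonempty (atVertex v) = _ , touching-hub (inj₁ v)

  -- The labels are the radial ends of the edge or corner that is crossed; if the link is left out
  -- of the tree, their root paths enter every bag. Links to a face or vertex node cross nothing and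
  -- repeat one label.
  record Link : Set where
    constructor link
    field
      source target : Piece
      label₁ label₂ : R
  open Link public

  edgeLink : Fin #E → Link
  edgeLink e = link (side e false) (side e true) (inj₁ (end e false)) (inj₁ (end e true))

  cornerLink : Flag → Link
  cornerLink a = link (pieceOf (flag a)) (pieceOf (flag (corner a)))
                      (inj₁ (vertexOf (flag a))) (inj₂ (face (flag a)))

  boundarySite : Fin #B → Site
  boundarySite b = proj₁ (boundaryOf-surjective b)

  boundaryLink : Fin #B → Link
  boundaryLink b = link (inFace (faceOf b)) (pieceOf (boundarySite b)) (inj₂ (faceOf b)) (inj₂ (faceOf b))

  vertexLink : Flag → Link
  vertexLink a = link (atVertex (vertexOf (flag a))) (pieceOf (flag a))
                      (inj₁ (vertexOf (flag a))) (inj₁ (vertexOf (flag a)))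

  edgeLinks cornerLinks boundaryLinks vertexLinks links : List Link
  edgeLinks     = map edgeLink (allFin #E)
  cornerLinks   = map cornerLink crossCorners
  boundaryLinks = map boundaryLink (allFin #B)
  vertexLinks   = map vertexLink vertexParentFlags
  links = edgeLinks ++ cornerLinks ++ boundaryLinks ++ vertexLinks

  edgeLink-∈ : ∀ e → edgeLink e ∈ links
  edgeLink-∈ e = ∈-++⁺ˡ (∈-map⁺ edgeLink (∈-allFin e))

  cornerLink-∈ : ∀ {a} → CrossCorner a → cornerLink a ∈ links
  cornerLink-∈ c = ∈-++⁺ʳ edgeLinks (∈-++⁺ˡ (∈-map⁺ cornerLink (∈-crossCorners c)))

  boundaryLink-∈ : ∀ b → boundaryLink b ∈ links
  boundaryLink-∈ b = ∈-++⁺ʳ edgeLinks (∈-++⁺ʳ cornerLinks (∈-++⁺ˡ (∈-map⁺ boundaryLink (∈-allFin b))))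

  vertexLink-∈ : ∀ {a} → VertexParentFlag a → vertexLink a ∈ links
  vertexLink-∈ {a} p = ∈-++⁺ʳ edgeLinks (∈-++⁺ʳ cornerLinks (∈-++⁺ʳ boundaryLinks
    (∈-map⁺ vertexLink (∈-filter⁺ vertexParentFlag? (flags-complete a) p))))

  length-links : length links ≡ #E + (length crossCorners + (#B + length vertexParentFlags))
  length-links = begin
    length links
      ≡⟨ length-++ edgeLinks ⟩
    length edgeLinks + length (cornerLinks ++ boundaryLinks ++ vertexLinks)
      ≡⟨ cong₂ _+_ (trans (length-map edgeLink (allFin #E)) (length-allFin #E)) (length-++ cornerLinks) ⟩
    #E + (length cornerLinks + length (boundaryLinks ++ vertexLinks))
      ≡⟨ cong₂ (λ c k → #E + (c + k)) (length-map cornerLink crossCorners) (length-++ boundaryLinks) ⟩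
    #E + (length crossCorners + (length boundaryLinks + length vertexLinks))
      ≡⟨ cong₂ (λ b v → #E + (length crossCorners + (b + v)))
           (trans (length-map boundaryLink (allFin #B)) (length-allFin #B)) (length-map vertexLink vertexParentFlags) ⟩
    #E + (length crossCorners + (#B + length vertexParentFlags)) ∎
    where open ≡-Reasoning

  -- If every link labelled by a descendant of x is available, then walking around
  -- the subtree of the radial tree below x connects all pieces that touch it.
  module Contour (_⇌_ : Rel Piece 0ℓ) (⇌-sym : Symmetric _⇌_) where

    Below : R → Piece → Set
    Below x p = ∃[ y ] y ∈ touching p × Anc x y

    -- Confining the path to `Below x` keeps it among the nodes that will hold `x`.
    Connected : R → Rel Piece 0ℓ
    Connected x = Star λ p q → p ⇌ q × Below x p × Below x q

    connected-sym : ∀ {x} → Symmetric (Connected x)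
    connected-sym = reverse λ (pq , p , q) → ⇌-sym pq , q , p

    connected-up : ∀ {c x p q} → Child c x → Connected c p q → Connected x p q
    connected-up c = Star.map λ (pq , (y , y∈ , a) , (z , z∈ , b)) →
      pq , (y , y∈ , anc-step c a) , (z , z∈ , anc-step c b)

    Available : R → Set
    Available x = ∀ {l} → l ∈ links → Anc x (label₁ l) ⊎ Anc x (label₂ l) → source l ⇌ target l

    Gathered : R → Set
    Gathered x = ∀ {y} p → Anc x y → y ∈ touching p → Connected x p (hub x)

    module _ {x : R} (available : Available x) (gathered : ∀ {c} → Child c x → Gathered c) where

      Around : Flag → Set
      Around a = EndOf (flag a) x

      around-corner : ∀ {a} → Around a → Around (corner a)
      around-corner = endOf-corner

      _≈_ : Rel Flag 0ℓ
      a ≈ b = Connected x (pieceOf (flag a)) (pieceOf (flag b))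

      below-site : ∀ s → EndOf s x → Below x (pieceOf s)
      below-site s xs = x , touching-pieceOf s xs , self

      below-hub : Below x (hub x)
      below-hub = x , touching-hub x , self

      -- Here `c` is a child of `x` and the corner is the tree edge between them. No link crosses
      -- it, but both flags touch `c`, so the way leads round the subtree below `c` through its hub.
      cross-tree : ∀ {a c} → parentFlag c ≡ just a → x ≢ c → Around a → a ≈ corner a
      cross-tree {a} {c} eq x≢c xa with parentFlag-sound eq
      ... | c↑ , spans = connected-up cx (gathered cx _ self (touching-pieceOf (flag a) ca)
              ◅◅ connected-sym (gathered cx _ self (touching-pieceOf (flag (corner a)) (endOf-corner ca))))
        where
        ca : EndOf (flag a) c
        ca = parentFlag-end eq
        parent≡x : Spans (flag a) c (parent c) → Around a → parent c ≡ x
        parent≡x (inj₁ e) (inj₁ refl) = contradiction (cong proj₁ e) x≢c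
        parent≡x (inj₁ e) (inj₂ refl) = sym (cong proj₂ e)
        parent≡x (inj₂ e) (inj₁ refl) = sym (cong proj₁ e)
        parent≡x (inj₂ e) (inj₂ refl) = contradiction (cong proj₂ e) x≢c
        cx : Child c x
        cx = subst (Child c) (parent≡x spans xa) c↑

      anc-label : ∀ {a} → Around a → Anc x (label₁ (cornerLink a)) ⊎ Anc x (label₂ (cornerLink a))
      anc-label (inj₁ refl) = inj₁ self
      anc-label (inj₂ refl) = inj₂ self

      uncorner : ∀ {a} → corner a ≈ corner (corner a) → a ≈ corner a
      uncorner {a} = connected-sym ∘ subst (corner a ≈_) (corner-involutive a)

      cross-link : ∀ {a} → CrossCorner a → Around a → a ≈ corner a
      cross-link c xa =
        return (available (cornerLink-∈ c) (anc-label xa) , below-site _ xa , below-site _ (around-corner xa))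

      -- A corner in the tree is passed round the subtree of a child, any other by its link, which
      -- is listed under the flag with the smaller key.
      cross : ∀ {a} → Around a → parentFlag x ≢ just a → parentFlag x ≢ just (corner a) → a ≈ corner a
      cross {a} xa ≢a ≢c with treeFlag? a | treeFlag? (corner a)
      ... | yes (c , eq) | _ = cross-tree eq (λ { refl → ≢a eq }) xa
      ... | no _ | yes (c , eq) = uncorner (cross-tree eq (λ { refl → ≢c eq }) (around-corner xa))
      ... | no ¬t | no ¬tc with ℕ.<-cmp (key a) (key (corner a))
      ...   | tri< lt _ _ = cross-link (lt , ¬t , ¬tc) xa
      ...   | tri≈ _ eq _ = contradiction (sym (key-injective eq)) (corner-free a)
      ...   | tri> _ _ gt = uncorner (cross-link
                ( subst (λ b → key (corner a) < key b) (sym (corner-involutive a)) gt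
                , ¬tc , ¬t ∘ subst TreeFlag (corner-involutive a))
                (around-corner xa))

      -- The corner towards the parent of x is bypassed by going round x the other way.
      module _ (τ : Flag → Flag) (τ-involutive : ∀ a → τ (τ a) ≡ a) (τ-free : ∀ a → τ a ≢ a)
        (around-τ : ∀ {a} → Around a → Around (τ a)) (cross-τ : ∀ {a} → Around a → a ≈ τ a) where

        open Dihedral flags-complete _≟ᶠˡ_ corner τ corner-involutive τ-involutive corner-free τ-free

        go-round : ∀ {a} → Around a → a ≈ corner a
        go-round {a} xa with parentFlag x in eq
        ... | nothing = cross xa (λ eq′ → contradiction (trans (sym eq) eq′) λ ())
                                 (λ eq′ → contradiction (trans (sym eq) eq′) λ ())
        ... | just p  = bypass xa (a ≟ᶠˡ p) (a ≟ᶠˡ corner p)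
          where
          avoid : ∀ {b} → Around b → b ≢ p → b ≢ corner p → b ≈ corner b
          avoid {b} xb b≢p b≢c = cross xb
            (λ eq′ → b≢p (just-injective (trans (sym eq′) eq)))
            (λ eq′ → b≢c (trans (sym (corner-involutive b)) (cong corner (just-injective (trans (sym eq′) eq)))))
          bypass : ∀ {b} → Around b → Dec (b ≡ p) → Dec (b ≡ corner p) → b ≈ corner b
          bypass xb (no b≢p)   (no b≢c)   = avoid xb b≢p b≢c
          bypass xp (yes refl) _          = detour around-corner around-τ _◅◅_ p cross-τ avoid xp
          -- The same corner seen from its other flag: the detour of `p` is reversed.
          bypass xc _          (yes refl) = uncorner
            (subst (λ b → b ≈ corner b) (sym (corner-involutive p))
              (bypass (subst Around (corner-involutive p) (around-corner xc)) (yes refl) (no (corner-free p ∘ sym))))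

    -- Rotating about `v`, across edges and corners in turn, reaches its parent flag, where the
    -- vertex node is attached. The piece of an isolated site is already the hub.
    vertex-hub : ∀ {v} → Available (inj₁ v) → (∀ {c} → Child c (inj₁ v) → Gathered c) →
                 ∀ s → vertexOf s ≡ v → Connected (inj₁ v) (pieceOf s) (atVertex v)
    vertex-hub available gathered (isolated _ _) refl = ε
    vertex-hub {v} available gathered (flag a) refl with parentFlag-vertex a
    ... | b , eq with parentFlag-end eq
    ...   | inj₁ eq-v = walk (Equivalence.to (rotation a b) (inj₁-injective eq-v)) (inj₁ refl) ◅◅
              subst (λ w → Connected (inj₁ v) (pieceOf (flag b)) (atVertex w)) (sym (inj₁-injective eq-v))
                (return (⇌-sym (available (vertexLink-∈ (subst (λ y → parentFlag y ≡ just b) eq-v eq))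
                                          (inj₁ (subst (Anc (inj₁ v)) eq-v self)))
                  , below-site available gathered (flag b) (inj₁ eq-v)
                  , subst (Below (inj₁ v) ∘ hub) eq-v (below-hub available gathered)))
      where
      open Corners corner
      anc-end : ∀ {e} i → inj₁ v ≡ inj₁ (end e i) →
                Anc (inj₁ v) (inj₁ (end e false)) ⊎ Anc (inj₁ v) (inj₁ (end e true))
      anc-end false eq = inj₁ (subst (Anc (inj₁ v)) eq self)
      anc-end true  eq = inj₂ (subst (Anc (inj₁ v)) eq self)
      around-side : ∀ {a} → Around available gathered a → Around available gathered (otherSide a)
      around-side (inj₁ eq) = inj₁ eq
      cross-edge : ∀ {a} → Around available gathered a → _≈_ available gathered a (otherSide a)
      cross-edge {a@(e , i , false)} (inj₁ eq) =
        return (available (edgeLink-∈ e) (anc-end i eq)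
          , below-site available gathered (flag a) (inj₁ eq)
          , below-site available gathered (flag (otherSide a)) (inj₁ eq))
      cross-edge {a@(e , i , true)} (inj₁ eq) =
        return (⇌-sym (available (edgeLink-∈ e) (anc-end i eq))
          , below-site available gathered (flag a) (inj₁ eq)
          , below-site available gathered (flag (otherSide a)) (inj₁ eq))
      walk : ∀ {a b} → Star AroundVertex a b → Around available gathered a → _≈_ available gathered a b
      walk ε                       _  = ε
      walk (acrossEdge a ◅ ss)   xa = cross-edge xa ◅◅ walk ss (around-side xa)
      walk (acrossCorner a ◅ ss) xa =
        go-round available gathered otherSide (λ (e , i , s) → cong (λ s → e , i , s) (Bool.not-involutive s))
          (λ (e , i , s) eq → Bool.not-¬ refl (sym (cong (proj₂ ∘ proj₂) eq))) around-side cross-edge xa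
        ◅◅ walk ss (endOf-corner xa)

    -- Following the facial walk of `s` reaches the site at which its boundary component is attached
    -- to the face node. Passing along an edge stays in the same piece; only corners need crossing.
    face-hub : ∀ {f} → Available (inj₂ f) → (∀ {c} → Child c (inj₂ f) → Gathered c) →
               ∀ s → face s ≡ f → Connected (inj₂ f) (pieceOf s) (inFace f)
    face-hub {f} available gathered s refl =
      walk (Equivalence.to (boundaryOf-orbits s (boundarySite b)) (sym b-eq)) (inj₂ refl) ◅◅
        return (⇌-sym (available (boundaryLink-∈ b) (inj₁ self))
          , below-site available gathered (boundarySite b) (inj₂ (cong (inj₂ ∘ faceOf) (sym b-eq)))
          , below-hub available gathered)
      where
      open Corners corner
      b : Fin #B
      b = boundaryOf s
      b-eq : boundaryOf (boundarySite b) ≡ b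
      b-eq = proj₂ (boundaryOf-surjective b)
      around-end : ∀ {a} → Around available gathered a → Around available gathered (otherEnd a)
      around-end {a} (inj₂ eq) = inj₂ (trans eq (cong inj₂ (sym (otherEnd-face a))))
      walk : ∀ {s t} → Star AlongBoundary s t → EndOf s (inj₂ f) → Connected (inj₂ f) (pieceOf s) (pieceOf t)
      walk ε                     _  = ε
      walk (followEdge a ◅ ss) xa = walk ss (around-end xa)
      walk (turnCorner a ◅ ss) xa =
        go-round available gathered otherEnd (λ (e , i , s) → cong (λ i → e , i , s) (Bool.not-involutive i))
          (λ (e , i , s) eq → Bool.not-¬ refl (sym (cong (proj₁ ∘ proj₂) eq))) around-end (λ _ → ε) xa
        ◅◅ walk ss (endOf-corner xa)

    site-hub : ∀ {x} → Available x → (∀ {c} → Child c x → Gathered c) →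
               ∀ s → EndOf s x → Connected x (pieceOf s) (hub x)
    site-hub available gathered s (inj₁ refl) = vertex-hub available gathered s refl
    site-hub available gathered s (inj₂ refl) = face-hub available gathered s refl

    -- A piece touching a proper descendant is led to the hub of the child `c` above it, and from
    -- there back to a corner or isolated site between `c` and `x`, where `site-hub` applies.
    gather : ∀ {x} → Available x → (∀ {c} → Child c x → Gathered c) → Gathered x
    gather {x} available gathered p x≤y y∈ with anc-child x≤y
    gather {x} available gathered p x≤y y∈ | inj₁ refl with touching-cases p y∈
    ... | inj₁ refl            = ε
    ... | inj₂ (s , refl , xs) = site-hub available gathered s xs
    gather {x} available gathered p x≤y y∈ | inj₂ (c , cx , c≤y) with ~-site c x (child-~ cx)
    ... | s , spans =
      connected-up cx (gathered cx p c≤y y∈ ◅◅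
        connected-sym (gathered cx (pieceOf s) self (touching-pieceOf s (proj₁ (spans-endOf spans)))))
      ◅◅ site-hub available gathered s (proj₂ (spans-endOf spans))

    gathered : ∀ {x} → Available x → Gathered x
    gathered {x} = go (suc depthBound) x (ℕ.m≤n+m (suc depthBound) (depth x))
      where
      -- Induction from the deepest level upwards: `k` = 0 would put `x` deeper than `depthBound`.
      -- Children inherit availability because their descendants are descendants of `x`.
      go : ∀ k x → depthBound < depth x + k → Available x → Gathered x
      go zero    x lt _ =
        contradiction (depth-bounded x) (ℕ.<⇒≱ (subst (depthBound <_) (ℕ.+-identityʳ (depth x)) lt))
      go (suc k) x lt available = gather available λ {c} cx → go k c
        (subst (depthBound <_) (trans (ℕ.+-suc (depth x) k) (cong (_+ k) (sym (proj₁ cx)))) lt)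
        λ l∈ → available l∈ ∘ [ inj₁ ∘ anc-step cx , inj₂ ∘ anc-step cx ]′

-- The layered tree-decomposition

∈-tabulate-does⁺ : ∀ {n} {P : Fin n → Set} (P? : Decidable P) {i} → P i → i Subset.∈ Vec.tabulate (does ∘ P?)
∈-tabulate-does⁺ P? {i} p = Vec.lookup⇒[]= i _ (trans (Vec.lookup∘tabulate (does ∘ P?) i) (dec-true (P? i) p))

∈-tabulate-does⁻ : ∀ {n} {P : Fin n → Set} (P? : Decidable P) {i} → i Subset.∈ Vec.tabulate (does ∘ P?) → P i
∈-tabulate-does⁻ P? {i} i∈ with P? i | trans (sym (Vec.lookup∘tabulate (does ∘ P?) i)) (Vec.[]=⇒lookup i∈)
... | yes p | _ = p

∣m-n∣≤1 : ∀ m n → m ≤ suc n → n ≤ suc m → ∣ m - n ∣ ≤ 1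
∣m-n∣≤1 zero    n       _         n≤1       = n≤1
∣m-n∣≤1 (suc m) zero    m≤1       _         = m≤1
∣m-n∣≤1 (suc m) (suc n) (s≤s m≤n) (s≤s n≤m) = ∣m-n∣≤1 m n m≤n n≤m

-- Doubles are even, so the spare 1 gains nothing.
double-cancel-≤ : ∀ {m n} → m + m ≤ suc (n + n) → m ≤ n
double-cancel-≤ {zero}          _  = z≤n
double-cancel-≤ {suc m} {zero}  le = contradiction (s≤s⁻¹ le) (λ le → ℕ.n≮0 (subst (_≤ 0) (ℕ.+-suc m m) le))
double-cancel-≤ {suc m} {suc n} le rewrite ℕ.+-suc m m | ℕ.+-suc n n = s≤s (double-cancel-≤ (s≤s⁻¹ (s≤s⁻¹ le)))

length-concatMap-≤ : ∀ {k} (f : A → List B) xs → (∀ x → length (f x) ≤ k) → length (concatMap f xs) ≤ length xs * k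
length-concatMap-≤ f []       _  = z≤n
length-concatMap-≤ f (x ∷ xs) f≤k =
  ℕ.≤-trans (ℕ.≤-reflexive (length-++ (f x))) (ℕ.+-mono-≤ (f≤k x) (length-concatMap-≤ f xs f≤k))

module Decomposition {g d : ℕ} (1≤d : 1 ≤ d) {n : ℕ} {G : Graph n} (map-graph : IsMapGraph g d G) where
  open IsMapGraph map-graph renaming (face to nationFace)
  open Pieces embedding

  N : ℕ
  N = #E * 2 + (#F + #V)

  coding : Fin N ↔ Piece
  coding = ↔-trans Fin.+↔⊎ (↔-trans Fin.*↔× (↔-refl ×-↔ Fin.2↔Bool) ⊎-↔ Fin.+↔⊎)

  decode : Fin N → Piece
  decode = Inverse.to coding

  code : Piece → Fin N
  code = Inverse.from coding

  decode-code : ∀ p → decode (code p) ≡ p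
  decode-code p = Inverse.inverseˡ coding refl

  code-decode : ∀ x → code (decode x) ≡ x
  code-decode x = Inverse.inverseʳ coding refl

  linkEnds : Link → Fin N × Fin N
  linkEnds l = code (source l) , code (target l)

  -- With no link left out, everything gathers at the hub of the root: each piece touches some
  -- radial element, and all of these descend from the root.
  joined : ∀ x → Star (Joined linkEnds links) (code (hub root)) x
  joined x with touching-nonempty (decode x)
  ... | y , y∈ = subst (Star _ _) (code-decode x) (Star.gmap code proj₁
          (connected-sym (gathered available (decode x) (anc-root depth≡0⇒root y) y∈)))
    where
    open Contour (λ p q → Joined linkEnds links (code p) (code q)) (joined-sym linkEnds)
    available : Available root
    available l∈ _ = lose l∈ (inj₁ refl)

  abstract
    spanning : Σ (Graph N) λ T → IsTree T × ∃[ xs ]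
      (∀ {l} → l ∈ links → l ∈ xs ⊎ uncurry (Graph.Adj T) (linkEnds l)) ×
      length xs + N ≤ suc (length links)
    spanning = spanningTree linkEnds links (code (hub root)) joined

  T : Graph N
  T = proj₁ spanning

  T-isTree : IsTree T
  T-isTree = proj₁ (proj₂ spanning)

  module T = Graph T

  excess : List Link
  excess = proj₁ (proj₂ (proj₂ spanning))

  -- Add three inequalities: the edge count of the spanning tree, the corner count and Euler's
  -- formula. `K` collects all terms common to both sides.
  length-excess : length excess ≤ g
  length-excess = ℕ.+-cancelʳ-≤ K _ _ (begin
    a + K                ≡⟨ left a #E #F #V c v #B ⟩
    (a + N) + (c + v + #F) + (#B + #E + 2)
      ≤⟨ ℕ.+-mono-≤ (ℕ.+-mono-≤ spanning-count chosen-count) (euler-bound embedding genus≤) ⟩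
    suc (#E + (c + (#B + v))) + suc (#E * 2) + (g + #V + 2 * #F)
      ≡⟨ right g #E #F #V c v #B ⟩
    g + K ∎)
    where
    open ℕ.≤-Reasoning
    spanning-count : length excess + N ≤ suc (#E + (length crossCorners + (#B + length vertexParentFlags)))
    spanning-count = subst (λ k → length excess + N ≤ suc k) length-links (proj₂ (proj₂ (proj₂ (proj₂ spanning))))
    a = length excess
    c = length crossCorners
    v = length vertexParentFlags
    K = 2 + #E * 3 + #F * 2 + #V + c + v + #B
    left : ∀ a e f w c v b →
           a + (2 + e * 3 + f * 2 + w + c + v + b) ≡ (a + (e * 2 + (f + w))) + (c + v + f) + (b + e + 2)
    left = ℕ-Solver.solve-∀
    right : ∀ g e f w c v b →
            suc (e + (c + (b + v))) + suc (e * 2) + (g + w + 2 * f) ≡ g + (2 + e * 3 + f * 2 + w + c + v + b)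
    right = ℕ-Solver.solve-∀

  excessLabels : List R
  excessLabels = concatMap (λ l → label₁ l ∷ label₂ l ∷ []) excess

  -- The lower ends of the root paths that make up the bag.
  tops : Fin N → List R
  tops x = touching (decode x) ++ excessLabels

  length-tops : ∀ x → length (tops x) ≤ 2 * g + 3
  length-tops x = begin
    length (tops x)
      ≡⟨ length-++ (touching (decode x)) ⟩
    length (touching (decode x)) + length excessLabels
      ≤⟨ ℕ.+-mono-≤ (length-touching (decode x)) (length-concatMap-≤ _ excess (λ _ → ℕ.≤-refl)) ⟩
    3 + length excess * 2
      ≤⟨ ℕ.+-monoʳ-≤ 3 (ℕ.*-monoˡ-≤ 2 length-excess) ⟩
    3 + g * 2
      ≡⟨ ℕ.+-comm 3 (g * 2) ⟩
    g * 2 + 3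
      ≡⟨ cong (_+ 3) (ℕ.*-comm g 2) ⟩
    2 * g + 3 ∎
    where open ℕ.≤-Reasoning

  Holds : R → Fin N → Set
  Holds y x = Any (Anc y) (tops x)

  holds-touching : ∀ {y} p → y ∈ touching p → Holds y (code p)
  holds-touching p y∈ = Any.++⁺ˡ (lose (subst (λ q → _ ∈ touching q) (sym (decode-code p)) y∈) self)

  Within : (Fin N → Set) → Rel (Fin N) 0ℓ
  Within P = Star λ a b → T.Adj a b × P a × P b

  within-sym : ∀ {P} → Symmetric (Within P)
  within-sym = reverse λ (ab , a , b) → T.sym ab , b , a

  -- If `y` is an ancestor of a label of a left-over link, every node holds it and the whole tree is
  -- available. Otherwise every link labelled by a descendant of `y` belongs to the tree, and the
  -- contour argument runs inside it.
  holds-connected : ∀ y {a b} → Holds y a → Holds y b → Within (Holds y) a b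
  holds-connected y {a} {b} ha hb with Any.any? (anc? _≟ᴿ_ y) excessLabels
  ... | yes e = Star.map (λ ab → ab , Any.++⁺ʳ (touching (decode _)) e , Any.++⁺ʳ (touching (decode _)) e)
                  (IsTree.connected T-isTree a b)
  ... | no ¬e = toHub ha ◅◅ within-sym (toHub hb)
    where
    open Contour (λ p q → T.Adj (code p) (code q)) T.sym
    available : Available y
    available {l} l∈ labelled with proj₁ (proj₂ (proj₂ (proj₂ spanning))) l∈
    ... | inj₂ adj = adj
    ... | inj₁ l∈e = contradiction (Any.concatMap⁺ _ (lose l∈e ([ here , (λ y≤l → there (here y≤l)) ]′ labelled))) ¬e
    holds : ∀ p → Below y p → Holds y (code p)
    holds p (z , z∈ , y≤z) = Any.++⁺ˡ (lose (subst (λ q → z ∈ touching q) (sym (decode-code p)) z∈) y≤z)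
    toHub : ∀ {a} → Holds y a → Within (Holds y) a (code (hub y))
    toHub {a} ha with Any.++⁻ (touching (decode a)) ha
    ... | inj₂ e = contradiction e ¬e
    ... | inj₁ t with find t
    ...   | z , z∈ , y≤z = subst (λ a → Within (Holds y) a (code (hub y))) (code-decode a)
              (Star.gmap code (λ {p} {q} (pq , bp , bq) → pq , holds p bp , holds q bq)
                (gathered available (decode a) y≤z z∈))

  -- Bags of nations

  Covers : Fin n → R → Set
  Covers u (inj₁ v) = Incident v (nationFace u)
  Covers u (inj₂ f) = nationFace u ≡ f

  covers? : ∀ u x → Dec (Covers u x)
  covers? u (inj₁ v) = incident? v (nationFace u)
  covers? u (inj₂ f) = nationFace u Fin.≟ f

  InBag : Fin N → Fin n → Set
  InBag x u = ∃[ y ] Covers u y × Holds y x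

  inBag? : ∀ x → Decidable (InBag x)
  inBag? x u = any-dec everyR-complete λ y → covers? u y ×-dec Any.any? (anc? _≟ᴿ_ y) (tops x)

  bag : Fin N → Subset n
  bag x = Vec.tabulate (does ∘ inBag? x)

  ∈-bag⁺ : ∀ {x u} → InBag x u → u Subset.∈ bag x
  ∈-bag⁺ {x} = ∈-tabulate-does⁺ (inBag? x)

  ∈-bag⁻ : ∀ {x u} → u Subset.∈ bag x → InBag x u
  ∈-bag⁻ {x} = ∈-tabulate-does⁻ (inBag? x)

  -- If `u` is held through a vertex, go within the nodes holding that vertex to a piece where it
  -- meets the face of `u`. This piece also holds the face, whose nodes lead on to its hub.
  bag-connected : ∀ u {x} → InBag x u → Within (λ x → u Subset.∈ bag x) x (code (inFace (nationFace u)))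
  bag-connected u {x} (inj₂ f , refl , held) =
    Star.map (λ (ab , a , b) → ab , ∈-bag⁺ (_ , refl , a) , ∈-bag⁺ (_ , refl , b))
      (holds-connected (inj₂ f) held (holds-touching (hub (inj₂ f)) (touching-hub (inj₂ f))))
  bag-connected u {x} (inj₁ v , inc@(s , refl , eq) , held) =
    Star.map (λ (ab , a , b) → ab , ∈-bag⁺ (inj₁ v , inc , a) , ∈-bag⁺ (inj₁ v , inc , b))
      (holds-connected (inj₁ v) held (holds-touching (pieceOf s) (touching-pieceOf s (inj₁ refl))))
    ◅◅ bag-connected u (_ , refl , holds-touching (pieceOf s) (touching-pieceOf s (inj₂ (cong inj₂ (sym eq)))))

  decomposition : TreeDecomposition G
  decomposition = record
    { nodes         = N
    ; tree          = T
    ; isTree        = T-isTree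
    ; bag           = bag
    ; vertexCovered = λ u → code (hub (inj₂ (nationFace u))) ,
        ∈-bag⁺ (_ , refl , holds-touching (hub (inj₂ (nationFace u))) (touching-hub (inj₂ (nationFace u))))
    ; edgeCovered   = λ {u} {w} uw → case proj₂ (Equivalence.to (adjacency u w) uw) of λ (v , p , q) →
        code (hub (inj₁ v)) , ∈-bag⁺ (inj₁ v , p , held v) , ∈-bag⁺ (inj₁ v , q , held v)
    ; coherent      = λ u x y x∈ y∈ → bag-connected u (∈-bag⁻ x∈) ◅◅ within-sym (bag-connected u (∈-bag⁻ y∈))
    }
    where
    held : ∀ v → Holds (inj₁ v) (code (hub (inj₁ v)))
    held v = holds-touching (hub (inj₁ v)) (touching-hub (inj₁ v))

  -- Faces lie at even and vertices at odd depth, the root being a face.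
  Parity : R → ℕ → Set
  Parity (inj₁ _) k = ∃[ i ] k ≡ suc (i + i)
  Parity (inj₂ _) k = ∃[ i ] k ≡ i + i

  walk-parity : ∀ k {x} → Walk k x → Parity x k
  walk-parity zero    refl = 0 , refl
  walk-parity (suc k) {inj₁ _} (inj₂ _ , w , _) with walk-parity k w
  ... | i , refl = i , refl
  walk-parity (suc k) {inj₂ _} (inj₁ _ , w , _) with walk-parity k w
  ... | i , refl = suc i , cong suc (sym (ℕ.+-suc i i))

  abstract
    -- Half the radial depth: faces that share a vertex are at radial distance at most 2, so their
    -- levels differ by at most 1.
    level : Fin #F → ℕ
    level f = proj₁ (walk-parity _ (depth-walk (inj₂ f)))

    depth-face : ∀ f → depth (inj₂ f) ≡ level f + level f
    depth-face f = proj₂ (walk-parity _ (depth-walk (inj₂ f)))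

  level-bounded : ∀ f → level f < suc depthBound
  level-bounded f = s≤s (ℕ.≤-trans (ℕ.m≤m+n _ _) (subst (_≤ depthBound) (depth-face f) (depth-bounded (inj₂ f))))

  level-close : ∀ {v f f′} → Incident v f → Incident v f′ → level f ≤ suc (level f′)
  level-close {v} {f} {f′} p q = double-cancel-≤ (begin
    level f + level f                       ≡⟨ depth-face f ⟨
    depth (inj₂ f)                          ≤⟨ depth-step {inj₁ v} {inj₂ f} p ⟩
    suc (depth (inj₁ v))                    ≤⟨ s≤s (depth-step {inj₂ f′} {inj₁ v} q) ⟩
    suc (suc (depth (inj₂ f′)))             ≡⟨ cong (λ k → suc (suc k)) (depth-face f′) ⟩
    suc (suc (level f′ + level f′))         ≡⟨ cong suc (ℕ.+-suc (level f′) (level f′)) ⟨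
    suc (level f′) + suc (level f′)         ≤⟨ ℕ.n≤1+n _ ⟩
    suc (suc (level f′) + suc (level f′))   ∎)
    where open ℕ.≤-Reasoning

  layering : Layering G
  layering = record
    { t       = depthBound
    ; layerOf = λ u → Fin.fromℕ< (level-bounded (nationFace u))
    ; close   = λ {u} {w} uw → case proj₂ (Equivalence.to (adjacency u w) uw) of λ (v , p , q) →
        subst (_≤ 1) (sym (cong₂ ∣_-_∣ (Fin.toℕ-fromℕ< (level-bounded (nationFace u)))
                                       (Fin.toℕ-fromℕ< (level-bounded (nationFace w)))))
          (∣m-n∣≤1 (level (nationFace u)) (level (nationFace w)) (level-close p q) (level-close q p))
    }

  open Layering layering using (layer; layerOf)

  ∈-layer⁻ : ∀ {u i} → u Subset.∈ layer i → level (nationFace u) ≡ toℕ i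
  ∈-layer⁻ {u} {i} u∈ = trans (sym (Fin.toℕ-fromℕ< _)) (cong toℕ (∈-tabulate-does⁻ (λ u → layerOf u Fin.≟ i) u∈))

  nationFace-injective : ∀ {u w} → nationFace u ≡ nationFace w → u ≡ w
  nationFace-injective eq = inverse-injective (nation-≡ eq)
    where
    nation-≡ : ∀ {p q : Nation} → proj₁ p ≡ proj₁ q → p ≡ q
    nation-≡ {_ , p} {_ , q} refl = cong (_ ,_) (≡-irrelevant p q)
    inverse-injective : ∀ {u w} → Inverse.to vertices u ≡ Inverse.to vertices w → u ≡ w
    inverse-injective eq = trans (sym (Inverse.inverseʳ vertices refl)) (Inverse.inverseʳ vertices eq)

  -- Counting the nations of one layer in a bag

  nationsAt : R → List (Fin n)
  nationsAt x = filter (λ u → covers? u x) (allFin n)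

  ∈-nationsAt⁺ : ∀ {u} x → Covers u x → u ∈ nationsAt x
  ∈-nationsAt⁺ x = ∈-filter⁺ (λ u → covers? u x) (∈-allFin _)

  ∈-nationsAt⁻ : ∀ {u} x → u ∈ nationsAt x → Covers u x
  ∈-nationsAt⁻ x u∈ = proj₂ (∈-filter⁻ (λ u → covers? u x) {xs = allFin n} u∈)

  nationsAt-unique : ∀ x → Unique (nationsAt x)
  nationsAt-unique x = Unique.filter⁺ (λ u → covers? u x) (Unique.allFin⁺ n)

  length-nationsAt-face : ∀ f → length (nationsAt (inj₂ f)) ≤ 1
  length-nationsAt-face f = unique-constant⇒length≤1 (nationsAt-unique (inj₂ f)) λ u∈ w∈ →
    nationFace-injective (trans (∈-nationsAt⁻ (inj₂ f) u∈) (sym (∈-nationsAt⁻ (inj₂ f) w∈)))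

  length-nationsAt : ∀ x → length (nationsAt x) ≤ d
  -- `ancestorAt` can return a face even for an odd level, when its starting point is not deep
  -- enough; `near` also asks for level 0 when `i` is 0. The bound then comes from `1≤d`.
  length-nationsAt (inj₂ f) = ℕ.≤-trans (length-nationsAt-face f) 1≤d
  length-nationsAt (inj₁ v) = subst (_≤ d) (length-map nationFace (nationsAt (inj₁ v)))
    (few v (map nationFace (nationsAt (inj₁ v))) (Unique.map⁺ nationFace-injective (nationsAt-unique (inj₁ v)))
      (All.tabulate λ f∈ → case ∈-map⁻ nationFace f∈ of λ { (u , u∈ , refl) →
        proj₂ (Inverse.to vertices u) , ∈-nationsAt⁻ (inj₁ v) u∈ }))

  nationAt : R → List (Fin n)
  nationAt (inj₁ _) = []
  nationAt (inj₂ f) = nationsAt (inj₂ f)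

  length-nationAt : ∀ x → length (nationAt x) ≤ 1
  length-nationAt (inj₁ _) = z≤n
  length-nationAt (inj₂ f) = length-nationsAt-face f

  -- A nation of level i in a bag is an ancestor of a top at depth 2 i, or is incident
  -- with one at depth 2 i - 1 or 2 i + 1.
  near : ℕ → R → List (Fin n)
  near i y = nationAt (ancestorAt (i + i) y) ++
             nationsAt (ancestorAt (suc (i + i)) y) ++ nationsAt (ancestorAt (pred (i + i)) y)

  length-near : ∀ i y → length (near i y) ≤ 2 * d + 1
  length-near i y = begin
    length (near i y)
      ≡⟨ trans (length-++ own) (cong (λ k → length own + k) (length-++ next)) ⟩
    length own + (length next + length previous)
      ≤⟨ ℕ.+-mono-≤ (length-nationAt (ancestorAt (i + i) y)) (ℕ.+-mono-≤ (length-nationsAt _) (length-nationsAt _)) ⟩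
    1 + (d + d)
      ≡⟨ cong (λ k → 1 + (d + k)) (sym (ℕ.+-identityʳ d)) ⟩
    1 + 2 * d
      ≡⟨ ℕ.+-comm 1 (2 * d) ⟩
    2 * d + 1 ∎
    where
    open ℕ.≤-Reasoning
    own next previous : List (Fin n)
    own      = nationAt (ancestorAt (i + i) y)
    next     = nationsAt (ancestorAt (suc (i + i)) y)
    previous = nationsAt (ancestorAt (pred (i + i)) y)

  -- A vertex at depth 2 `k` + 1 on a face at depth 2 `i` differs from it in depth by at most 1, and
  -- parity leaves only `k` = `i` or `k` + 1 = `i`.
  ∈-near : ∀ {u x y} → Covers u x → Anc x y → u ∈ near (level (nationFace u)) y
  ∈-near {u} {inj₂ f} {y} refl a = ∈-++⁺ˡ (subst (λ z → u ∈ nationAt z) at (∈-nationsAt⁺ (inj₂ f) refl))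
    where
    at : inj₂ f ≡ ancestorAt (level f + level f) y
    at = trans (anc-at a) (cong (λ k → ancestorAt k y) (depth-face f))
  ∈-near {u} {inj₁ v} {y} inc a with walk-parity _ (depth-walk (inj₁ v))
  ... | k , eq = ∈-++⁺ʳ (nationAt (ancestorAt (i + i) y)) (choose (ℕ.m≤n⇒m<n∨m≡n k≤i))
    where
    i : ℕ
    i = level (nationFace u)
    k≤i : k ≤ i
    k≤i = double-cancel-≤ (ℕ.m≤n⇒m≤1+n (s≤s⁻¹ (ℕ.≤-trans (ℕ.≤-reflexive (sym eq))
      (ℕ.≤-trans (depth-step {inj₂ (nationFace u)} {inj₁ v} inc) (ℕ.≤-reflexive (cong suc (depth-face _)))))))
    i≤suc-k : i ≤ suc k
    i≤suc-k = double-cancel-≤ (ℕ.≤-trans (ℕ.≤-reflexive (sym (depth-face _)))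
      (ℕ.≤-trans (depth-step {inj₁ v} {inj₂ (nationFace u)} inc)
      (ℕ.≤-trans (ℕ.≤-reflexive (cong suc eq))
      (ℕ.≤-trans (ℕ.≤-reflexive (cong suc (sym (ℕ.+-suc k k)))) (ℕ.n≤1+n _)))))
    at : ∀ {j} → depth (inj₁ v) ≡ j → u ∈ nationsAt (ancestorAt j y)
    at eq′ = subst (λ z → u ∈ nationsAt z) (trans (anc-at a) (cong (λ j → ancestorAt j y) eq′))
               (∈-nationsAt⁺ (inj₁ v) inc)
    choose : k < i ⊎ k ≡ i → u ∈ nationsAt (ancestorAt (suc (i + i)) y) ++ nationsAt (ancestorAt (pred (i + i)) y)
    choose (inj₁ k<i) = ∈-++⁺ʳ (nationsAt (ancestorAt (suc (i + i)) y)) (at (trans eq below))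
      where
      below : suc (k + k) ≡ pred (i + i)
      below rewrite ℕ.≤-antisym i≤suc-k k<i = sym (ℕ.+-suc k k)
    choose (inj₂ k≡i) = ∈-++⁺ˡ (at (trans eq (cong (λ k → suc (k + k)) k≡i)))

  width : ∀ x i → ∣ bag x ∩ layer i ∣ ≤ (2 * g + 3) * (2 * d + 1)
  width x i = begin
    ∣ bag x ∩ layer i ∣                        ≤⟨ ∣⊆list∣ _ (concatMap (near (toℕ i)) (tops x)) listed ⟩
    length (concatMap (near (toℕ i)) (tops x)) ≤⟨ length-concatMap-≤ (near (toℕ i)) (tops x) (length-near (toℕ i)) ⟩
    length (tops x) * (2 * d + 1)              ≤⟨ ℕ.*-monoˡ-≤ (2 * d + 1) (length-tops x) ⟩
    (2 * g + 3) * (2 * d + 1)                  ∎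
    where
    open ℕ.≤-Reasoning
    listed : ∀ {u} → u Subset.∈ bag x ∩ layer i → u ∈ concatMap (near (toℕ i)) (tops x)
    listed {u} u∈ with x∈p∩q⁻ (bag x) (layer i) u∈
    ... | u∈x , u∈i with ∈-bag⁻ u∈x
    ...   | y , covers , held = ∈-concatMap⁺ (near (toℕ i))
            (Any.map (λ a → subst (λ j → u ∈ near j _) (∈-layer⁻ u∈i) (∈-near covers a)) held)

theorem25 : ∀ (g d : ℕ) → 1 ≤ d → ∀ {n : ℕ} (G : Graph n) → IsMapGraph g d G →
    LayeredTreewidth≤ G ((2 * g + 3) * (2 * d + 1))
theorem25 g d 1≤d G map-graph = decomposition , layering , width
  where open Decomposition 1≤d map-graph
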